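{- Let $G$ be a tree of order $n\geq 2$. Then $\operatorname{avd}(G)\leq \frac{2n}{3}$. Moreover, $\operatorname{avd}(G)=\frac{2n}{3}$ if and only if every non-leaf vertex of $G$ is a support vertex with one or two leaf neighbors.
   Context: All graphs are finite, simple and undirected. A set $S\subseteq V(G)$ is a dominating set of $G$ if every vertex of $V(G)\setminus S$ is adjacent to some vertex of $S$. Let $\mathcal{D}(G)$ be the family of all dominating sets of $G$. The average order of a dominating set of $G$ is $\operatorname{avd}(G)=\frac{\sum_{S\in\mathcal{D}(G)}|S|}{|\mathcal{D}(G)|}$. A leaf is a vertex of degree one; a support vertex is a vertex adjacent to at least one leaf; the leaf neighbors of a vertex $u$ are the leaves adjacent to $u$. -}

module Defs where

open import Data.Bool using (Bool; true; false; T)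
open import Data.Nat using (ℕ; zero; suc; _+_; _*_; _≤_; _≥_)
open import Data.Fin using (Fin)
open import Data.Fin.Subset using (Subset; _∈_; ∣_∣)
open import Data.Fin.Subset.Properties using (_∈?_)
open import Data.Fin.Properties using (any?; all?)
open import Data.Vec using (Vec; []; _∷_)
open import Data.Nat.ListAction using (sum)
open import Data.List using (List; []; _∷_; length; filter; map; allFin; concatMap; head; last)
open import Data.List.Relation.Unary.Linked using (Linked)
open import Data.List.Relation.Unary.Unique.Propositional using (Unique)
open import Data.Maybe using (Maybe; just; nothing)
open import Data.Product using (Σ; ∃; _×_; _,_)
open import Data.Sum using (_⊎_)
open import Relation.Binary.PropositionalEquality using (_≡_)
open import Relation.Nullary using (¬_; Dec)
open import Relation.Nullary.Decidable using (_⊎-dec_; _×-dec_)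

record Graph (n : ℕ) : Set where
  field
    adj   : Fin n → Fin n → Bool
    sym   : ∀ u v → adj u v ≡ adj v u
    irref : ∀ v → adj v v ≡ false
open Graph public

Adj : ∀ {n} → Graph n → Fin n → Fin n → Set
Adj G u v = T (adj G u v)

IsWalkFromTo : ∀ {n} → Graph n → Fin n → Fin n → List (Fin n) → Set
IsWalkFromTo G u v ws = Linked (Adj G) ws × head ws ≡ just u × last ws ≡ just v

Connected : ∀ {n} → Graph n → Set
Connected {n} G = ∀ (u v : Fin n) → ∃ λ ws → IsWalkFromTo G u v ws

IsCycle : ∀ {n} → Graph n → List (Fin n) → Set
IsCycle {n} G vs =
  length vs ≥ 3 × Unique vs × Linked (Adj G) vs ×
  Σ (Fin n) λ a → Σ (Fin n) λ b → head vs ≡ just a × last vs ≡ just b × Adj G b a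

Acyclic : ∀ {n} → Graph n → Set
Acyclic G = ∀ vs → ¬ IsCycle G vs

IsTree : ∀ {n} → Graph n → Set
IsTree G = Connected G × Acyclic G

degree : ∀ {n} → Graph n → Fin n → ℕ
degree {n} G v = length (filter (λ u → Data.Bool.T? (adj G v u)) (allFin n))
  where import Data.Bool

IsLeaf : ∀ {n} → Graph n → Fin n → Set
IsLeaf G v = degree G v ≡ 1

IsLeaf? : ∀ {n} (G : Graph n) v → Dec (IsLeaf G v)
IsLeaf? G v = Data.Nat.Properties._≟_ (degree G v) 1
  where import Data.Nat.Properties

IsSupport : ∀ {n} → Graph n → Fin n → Set
IsSupport {n} G v = Σ (Fin n) λ u → Adj G v u × IsLeaf G u

leafNeighbors : ∀ {n} → Graph n → Fin n → ℕ
leafNeighbors {n} G v =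
  length (filter (λ u → Data.Bool.T? (adj G v u) ×-dec IsLeaf? G u) (allFin n))
  where import Data.Bool

IsDominating : ∀ {n} → Graph n → Subset n → Set
IsDominating {n} G S = ∀ (v : Fin n) → v ∈ S ⊎ Σ (Fin n) λ u → u ∈ S × Adj G u v

IsDominating? : ∀ {n} (G : Graph n) S → Dec (IsDominating G S)
IsDominating? G S =
  all? λ v → (v ∈? S) ⊎-dec any? (λ u → (u ∈? S) ×-dec Data.Bool.T? (adj G u v))
  where import Data.Bool

allSubsets : (n : ℕ) → List (Subset n)
allSubsets zero = [] ∷ []
allSubsets (suc n) = concatMap (λ s → (false ∷ s) ∷ (true ∷ s) ∷ []) (allSubsets n)

dominatingSets : ∀ {n} → Graph n → List (Subset n)
dominatingSets {n} G = filter (IsDominating? G) (allSubsets n)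

numDom : ∀ {n} → Graph n → ℕ
numDom G = length (dominatingSets G)

sumDom : ∀ {n} → Graph n → ℕ
sumDom G = sum (map ∣_∣ (dominatingSets G))

-- avd(G) ≤ 2n/3 and avd(G) = 2n/3, cross-multiplied (|D(G)| ≥ 1 always,
-- as V(G) is dominating), i.e. sumDom/numDom ≤ 2n/3.
AvdLe2n/3 : ∀ {n} → Graph n → Set
AvdLe2n/3 {n} G = 3 * sumDom G ≤ 2 * n * numDom G

AvdEq2n/3 : ∀ {n} → Graph n → Set
AvdEq2n/3 {n} G = 3 * sumDom G ≡ 2 * n * numDom G

{-# OPTIONS --safe #-}

-- Give every vertex the weight 1 + ε if it is chosen and 1 - 2 ε otherwise,
-- over the dual numbers ℤ[ε].  The total weight of the dominating sets is then
-- |D(G)| + (3 ∑|S| - 2 n |D(G)|) ε, so the theorem says that its ε-coefficient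
-- is at most 0 and describes when it vanishes.
--
-- Root the tree.  Let X, B, Y be the total weights of the subsets of a rooted
-- tree which dominate all vertices but possibly the root and in which the root
-- is chosen, not chosen, or not chosen but dominated.  Over the children c,
-- X is the product of X c + B c, B that of X c + Y c, and B - Y that of Y c, up
-- to the root's own weight.  An induction on the tree shows that the
-- ε-coefficient of X + B is at most -(B - Y); together with the Weierstrass
-- inequality ∏ (1 - z) ≥ 1 - ∑ z this makes the ε-coefficient of X + Y at most
-- 0 as soon as there are two vertices.  Equality forces every non-leaf vertex
-- to have one or two leaf children, provided that the root is not a leaf.
--
-- The graph is turned into a rooted tree by pruning its leaves other than the
-- root one after the other, storing at each remaining vertex the rooted tree
-- that has been pruned there.
module Submission where

open import Defs hiding (sym)
open import Algebra.Bundles using (CommutativeMonoid; CommutativeSemiring)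
import Algebra.Properties.CommutativeMonoid.Sum as CommutativeMonoidSum
import Algebra.Properties.CommutativeSemigroup as CommutativeSemigroupProperties
open import Algebra.Structures.Biased using (isCommutativeSemiringˡ)
open import Data.Empty using (⊥; ⊥-elim)
open import Data.Integer using (ℤ; +_; 0ℤ; 1ℤ; _+_; _*_; _-_; -_; _≤_; +≤+; +[1+_])
import Data.Integer.Properties as ℤ
open import Data.Integer.Tactic.RingSolver using (solve; solve-∀)
open import Data.List as List using (List; []; _∷_; length; filter; map; concatMap; last)
open import Data.Nat as ℕ using (ℕ; zero; suc; z≤n; s≤s; _≡ᵇ_)
import Data.Nat.Properties as ℕ
open import Data.Product using (∃; _×_; _,_; proj₁; proj₂)
open import Data.Sum using (_⊎_; inj₁; inj₂)
open import Data.Unit using (⊤; tt)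
open import Function using (id; case_of_; _∘_; _⇔_; mk⇔; Equivalence)
open import Level using (0ℓ)
open import Relation.Binary.PropositionalEquality
  using (_≡_; _≢_; refl; sym; trans; cong; cong₂; subst; subst₂; isEquivalence; module ≡-Reasoning)
import Relation.Binary.Reasoning.Setoid as SetoidReasoning
open import Relation.Nullary using (¬_; yes; no; does)
open import Relation.Nullary.Decidable using (_×-dec_; ¬?)
open import Relation.Unary using (Decidable)

-- Rooted trees and their weights

infixl 5 _◁_

-- r ◁ c attaches c as a further child of the root of r.
data Rooted : Set where
  •   : Rooted
  _◁_ : (r c : Rooted) → Rooted

children : Rooted → ℕ
children •       = 0
children (r ◁ c) = suc (children r)

pendant : Rooted → ℕ
pendant •       = 1
pendant (_ ◁ _) = 0

leaves : Rooted → ℕ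
leaves •       = 0
leaves (r ◁ c) = pendant c ℕ.+ leaves r

OneOrTwo : ℕ → Set
OneOrTwo n = 1 ℕ.≤ n × n ℕ.≤ 2

Supported : Rooted → Set
Supported •       = ⊤
Supported (r ◁ c) = Supported r × Supported c × (children c ≢ 0 → OneOrTwo (leaves c))

-- Generating functions of the subsets that dominate every vertex except
-- possibly the root: the root is chosen (X), is not chosen (B), or is not
-- chosen but dominated by a child (Y).
module RootedWeights {c ℓ} (R : CommutativeSemiring c ℓ)
                     (w₁ w₀ : CommutativeSemiring.Carrier R) where
  open CommutativeSemiring R using (Carrier; 0#) renaming (_+_ to _⊕_; _*_ to _⊗_)

  X B Y : Rooted → Carrier
  X •       = w₁
  X (r ◁ c) = X r ⊗ (X c ⊕ B c)
  B •       = w₀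
  B (r ◁ c) = B r ⊗ (X c ⊕ Y c)
  Y •       = 0#
  Y (r ◁ c) = (B r ⊗ X c) ⊕ (Y r ⊗ Y c)

-- Bounds for rooted trees

infixl 6 _⊹_
infixl 7 _⊛_

_⊹_ : ∀ {a b} → 0ℤ ≤ a → 0ℤ ≤ b → 0ℤ ≤ a + b
p ⊹ q = ℤ.+-mono-≤ p q

_⊛_ : ∀ {a b} → 0ℤ ≤ a → 0ℤ ≤ b → 0ℤ ≤ a * b
_⊛_ {+ m} {+ n} _ _ = subst (0ℤ ≤_) (ℤ.pos-* m n) (+≤+ z≤n)

0≤+ : ∀ {n} → 0ℤ ≤ + n
0≤+ = +≤+ z≤n

slack : ∀ {a b} → a ≤ b → 0ℤ ≤ b - a
slack = ℤ.i≤j⇒0≤j-i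

-- Inequalities below are proved by certificate: `b - a` is a sum of products of known nonnegative
-- slacks, and the ring solver checks the identity.
bySlack : ∀ {a b e} → 0ℤ ≤ e → b - a ≡ e → a ≤ b
bySlack h eq = ℤ.0≤i-j⇒j≤i (subst (0ℤ ≤_) (sym eq) h)

-- The argument order lets h determine the middle term before eq is solved.
via : ∀ {a b c : ℤ} → b ≡ c → a ≡ b → a ≡ c
via h eq = trans eq h

1≤⇒0≤ : ∀ {a} → 1ℤ ≤ a → 0ℤ ≤ a
1≤⇒0≤ = ℤ.≤-trans 0≤+

0≤2*⇒0≤ : ∀ {a} → 0ℤ ≤ + 2 * a → 0ℤ ≤ a
0≤2*⇒0≤ {+ _} _ = 0≤+

2*-injective : ∀ {a b} → + 2 * a ≡ + 2 * b → a ≡ b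
2*-injective = ℤ.*-cancelˡ-≡ (+ 2) _ _

+≡0⇒≡0ˡ : ∀ {a b} → 0ℤ ≤ a → 0ℤ ≤ b → a + b ≡ 0ℤ → a ≡ 0ℤ
+≡0⇒≡0ˡ {+ zero}   {+ _} _ _ _ = refl

+≡0⇒≡0ʳ : ∀ {a b} → 0ℤ ≤ a → 0ℤ ≤ b → a + b ≡ 0ℤ → b ≡ 0ℤ
+≡0⇒≡0ʳ {+ zero} {+ zero} _ _ _ = refl

*≡0⇒≡0ʳ : ∀ {a b} → 1ℤ ≤ a → a * b ≡ 0ℤ → b ≡ 0ℤ
*≡0⇒≡0ʳ {a} h eq with ℤ.i*j≡0⇒i≡0∨j≡0 a eq
... | inj₁ refl = case h of λ { (+≤+ ()) }
... | inj₂ b≡0  = b≡0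

1≰0 : 1ℤ ≤ 0ℤ → ⊥
1≰0 (+≤+ ())

-- The next two records collect what is known about a rooted tree, where
-- unprimed letters are values and primed ones the coefficients of ε.
-- Spine holds at every stage of attaching children to a root, with j the
-- number of leaf children so far and p = 2 ^ j.  Its upper bounds on x′ are
-- the Weierstrass inequality ∏ (1 - z) ≥ 1 - ∑ z over the non-leaf children,
-- with z the share of the subsets leaving that child undominated.
record Spine (j p x x′ b b′ : ℤ) : Set where
  field
    1≤p  : 1ℤ ≤ p
    1≤b  : 1ℤ ≤ b
    pb≤x : p * b ≤ x
    x′≤₁ : + 2 * x′ + j * x ≤ + 2 * (p * b)
    x′≤₂ : + 2 * x′ + (j - 1ℤ) * x ≤ p * b
    b′≤  : b′ ≤ (j - + 2) * b

  0≤p : 0ℤ ≤ p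
  0≤p = 1≤⇒0≤ 1≤p

  0≤b : 0ℤ ≤ b
  0≤b = 1≤⇒0≤ 1≤b

  b≤x : b ≤ x
  b≤x = bySlack (slack 1≤p ⊛ 0≤b ⊹ slack pb≤x) (solve (p ∷ b ∷ x ∷ []))

  1≤x : 1ℤ ≤ x
  1≤x = ℤ.≤-trans 1≤b b≤x

  0≤x : 0ℤ ≤ x
  0≤x = 1≤⇒0≤ 1≤x

-- What a parent uses about a child that is not a leaf.
record Branch (x x′ b b′ y y′ : ℤ) : Set where
  field
    1≤y     : 1ℤ ≤ y
    y<x     : 1ℤ + y ≤ x
    y≤b     : y ≤ b
    b≤x     : b ≤ x
    x′≤x    : x′ ≤ x
    x′+b′≤  : x′ + b′ ≤ y - b
    x′+y′≤0 : x′ + y′ ≤ 0ℤ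
    balance : b + (x′ + b′) + x′ ≤ x

  0≤y : 0ℤ ≤ y
  0≤y = 1≤⇒0≤ 1≤y

  0≤b : 0ℤ ≤ b
  0≤b = ℤ.≤-trans 0≤y y≤b

  0≤x : 0ℤ ≤ x
  0≤x = ℤ.≤-trans 0≤b b≤x

-- All bounds of `Spine` attained. The ratio of ε-coefficient to value adds up over factors: a
-- chosen root gives 1 and each leaf child -1/2, an unchosen root gives -2 and each leaf child 1,
-- and a non-leaf child in the equality case gives 0.
record Exact (j p x x′ b b′ : ℤ) : Set where
  field
    x≡  : x ≡ p * b
    x′≡ : + 2 * x′ ≡ (+ 2 - j) * x
    b′≡ : b′ ≡ (j - + 2) * b

-- Equality in x′≤₂; it holds exactly when all non-leaf children have one or
-- two leaf children, recursively.
Tight : (j p x x′ b b′ : ℤ) → Set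
Tight j p x x′ b b′ = p * b - (+ 2 * x′ + (j - 1ℤ) * x) ≡ 0ℤ

spine-• : Spine 0ℤ 1ℤ 1ℤ 1ℤ 1ℤ (- + 2)
spine-• = record
  { 1≤p = ℤ.≤-refl ; 1≤b = ℤ.≤-refl ; pb≤x = ℤ.≤-refl
  ; x′≤₁ = ℤ.≤-refl ; x′≤₂ = ℤ.≤-refl ; b′≤ = ℤ.≤-refl }

exact-• : Exact 0ℤ 1ℤ 1ℤ 1ℤ 1ℤ (- + 2)
exact-• = record { x≡ = refl ; x′≡ = refl ; b′≡ = refl }

module _ (j p x x′ b b′ : ℤ) where

  -- A leaf child contributes the factor 2 - ε to X and 1 + ε to B. The terms are left as the
  -- recursion of `X` and `B` unfolds them.
  spine-leaf : Spine j p x x′ b b′ →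
    Spine (1ℤ + j) (+ 2 * p) (x * + 2) (x′ * + 2 + x * (- 1ℤ)) (b * 1ℤ) (b′ * 1ℤ + b * 1ℤ)
  spine-leaf s = record
    { 1≤p  = bySlack (0≤p ⊹ slack 1≤p) (solve (p ∷ []))
    ; 1≤b  = bySlack (slack 1≤b) (solve (b ∷ []))
    ; pb≤x = bySlack (0≤+ {2} ⊛ slack pb≤x) (solve (p ∷ b ∷ x ∷ []))
    ; x′≤₁ = bySlack (0≤+ {2} ⊛ slack x′≤₁) (solve (j ∷ p ∷ b ∷ x ∷ x′ ∷ []))
    ; x′≤₂ = bySlack (0≤+ {2} ⊛ slack x′≤₂) (solve (j ∷ p ∷ b ∷ x ∷ x′ ∷ []))
    ; b′≤  = bySlack (slack b′≤) (solve (j ∷ b ∷ b′ ∷ []))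
    }
    where open Spine s

  tight-leaf : Tight (1ℤ + j) (+ 2 * p) (x * + 2) (x′ * + 2 + x * (- 1ℤ)) (b * 1ℤ) (b′ * 1ℤ + b * 1ℤ) →
    Tight j p x x′ b b′
  tight-leaf h = 2*-injective (via h (solve (j ∷ p ∷ b ∷ x ∷ x′ ∷ [])))

  exact-leaf : Exact j p x x′ b b′ →
    Exact (1ℤ + j) (+ 2 * p) (x * + 2) (x′ * + 2 + x * (- 1ℤ)) (b * 1ℤ) (b′ * 1ℤ + b * 1ℤ)
  exact-leaf e = record
    { x≡  = trans (cong (_* + 2) x≡) (solve (p ∷ b ∷ []))
    ; x′≡ = trans (via (cong (λ z → + 2 * z - + 2 * x) x′≡) (solve (x ∷ x′ ∷ []))) (solve (x ∷ j ∷ []))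
    ; b′≡ = trans (cong (λ z → z * 1ℤ + b * 1ℤ) b′≡) (solve (j ∷ b ∷ []))
    }
    where open Exact e

  module _ (X X′ B B′ Y Y′ : ℤ) where

    -- One step of the Weierstrass product: with z = (B - Y)/(X + B), the factor 1 - z lowers pb/x
    -- by at most z because pb ≤ x, while x′/x drops by at least z.
    spine-branch : Spine j p x x′ b b′ → Branch X X′ B B′ Y Y′ →
      Spine j p (x * (X + B)) (x′ * (X + B) + x * (X′ + B′)) (b * (X + Y)) (b′ * (X + Y) + b * (X′ + Y′))
    spine-branch s c = record
      { 1≤p  = S.1≤p
      ; 1≤b  = bySlack (S.0≤b ⊛ C.0≤x ⊹ S.0≤b ⊛ slack C.1≤y ⊹ slack S.1≤b) (solve (b ∷ X ∷ Y ∷ []))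
      ; pb≤x = bySlack (slack S.pb≤x ⊛ (C.0≤x ⊹ C.0≤b) ⊹ S.0≤p ⊛ S.0≤b ⊛ slack C.y≤b)
                       (solve (p ∷ b ∷ x ∷ X ∷ B ∷ Y ∷ []))
      ; x′≤₁ = bySlack (slack S.x′≤₁ ⊛ (C.0≤x ⊹ C.0≤b)
                         ⊹ 0≤+ {2} ⊛ (S.0≤x ⊛ slack C.x′+b′≤ ⊹ slack S.pb≤x ⊛ slack C.y≤b))
                       (solve (j ∷ p ∷ b ∷ x ∷ x′ ∷ X ∷ X′ ∷ B ∷ B′ ∷ Y ∷ []))
      ; x′≤₂ = bySlack (slack S.x′≤₂ ⊛ (C.0≤x ⊹ C.0≤b)
                         ⊹ 0≤+ {2} ⊛ (S.0≤x ⊛ slack C.x′+b′≤)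
                         ⊹ (S.0≤x ⊹ slack S.pb≤x) ⊛ slack C.y≤b)
                       (solve (j ∷ p ∷ b ∷ x ∷ x′ ∷ X ∷ X′ ∷ B ∷ B′ ∷ Y ∷ []))
      ; b′≤  = bySlack (slack S.b′≤ ⊛ (C.0≤x ⊹ C.0≤y) ⊹ S.0≤b ⊛ slack C.x′+y′≤0)
                       (solve (j ∷ b ∷ b′ ∷ X ∷ X′ ∷ Y ∷ Y′ ∷ []))
      }
      where
      module S = Spine s
      module C = Branch c

    -- The new slack is a sum of three nonnegative terms, so each vanishes; cancelling the positive
    -- factors X + B and x gives the two conclusions.
    tight-branch : Spine j p x x′ b b′ → Branch X X′ B B′ Y Y′ →
      Tight j p (x * (X + B)) (x′ * (X + B) + x * (X′ + B′)) (b * (X + Y)) (b′ * (X + Y) + b * (X′ + Y′)) →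
      Tight j p x x′ b b′ × X′ + B′ ≡ 0ℤ
    tight-branch s c h = *≡0⇒≡0ʳ 1≤A (+≡0⇒≡0ˡ u≥0 v≥0 (+≡0⇒≡0ˡ (u≥0 ⊹ v≥0) w≥0 sum≡0))
                       , ℤ.neg-injective (*≡0⇒≡0ʳ S.1≤x (+≡0⇒≡0ʳ u≥0 v≥0 (+≡0⇒≡0ˡ (u≥0 ⊹ v≥0) w≥0 sum≡0)))
      where
      module S = Spine s
      module C = Branch c
      1≤A : 1ℤ ≤ X + B
      1≤A = ℤ.+-mono-≤ (ℤ.≤-trans C.1≤y (ℤ.≤-trans C.y≤b C.b≤x)) C.0≤b
      u≥0 : 0ℤ ≤ (X + B) * (p * b - (+ 2 * x′ + (j - 1ℤ) * x))
      u≥0 = (C.0≤x ⊹ C.0≤b) ⊛ slack S.x′≤₂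
      n≥0 : 0ℤ ≤ - (X′ + B′)
      n≥0 = bySlack (slack C.y≤b ⊹ slack C.x′+b′≤) (solve (X′ ∷ B′ ∷ B ∷ Y ∷ []))
      v≥0 : 0ℤ ≤ x * (- (X′ + B′))
      v≥0 = S.0≤x ⊛ n≥0
      w≥0 : 0ℤ ≤ x * (Y - B - (X′ + B′)) + (x - p * b) * (B - Y)
      w≥0 = S.0≤x ⊛ slack C.x′+b′≤ ⊹ slack S.pb≤x ⊛ slack C.y≤b
      sum≡0 : (X + B) * (p * b - (+ 2 * x′ + (j - 1ℤ) * x)) + x * (- (X′ + B′))
              + (x * (Y - B - (X′ + B′)) + (x - p * b) * (B - Y)) ≡ 0ℤ
      sum≡0 = via h (solve (j ∷ p ∷ b ∷ x ∷ x′ ∷ X ∷ X′ ∷ B ∷ B′ ∷ Y ∷ []))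

    -- The new factors of X and B are then both X + B with ε-coefficient 0, so the ratios recorded
    -- in `Exact` persist.
    exact-branch : Exact j p x x′ b b′ → Y ≡ B → Y′ ≡ B′ → X′ + B′ ≡ 0ℤ →
      Exact j p (x * (X + B)) (x′ * (X + B) + x * (X′ + B′)) (b * (X + Y)) (b′ * (X + Y) + b * (X′ + Y′))
    exact-branch e refl refl n≡0 = record
      { x≡  = trans (cong (_* (X + B)) x≡) (solve (p ∷ b ∷ X ∷ B ∷ []))
      ; x′≡ = trans (cong (λ z → + 2 * (x′ * (X + B) + x * z)) n≡0)
                (trans (via (cong (_* (X + B)) x′≡) (solve (x ∷ x′ ∷ X ∷ B ∷ [])))
                       (solve (j ∷ x ∷ X ∷ B ∷ [])))
      ; b′≡ = trans (cong₂ (λ u v → u * (X + B) + b * v) b′≡ n≡0) (solve (j ∷ b ∷ X ∷ B ∷ []))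
      }
      where open Exact e

-- The additional bounds when there are children but none is a leaf.
record Leafless (x′ b y y′ : ℤ) : Set where
  field
    y<b     : 1ℤ + y ≤ b
    b<2y    : 1ℤ + b ≤ + 2 * y
    y′≤-y   : y′ ≤ - y
    x′+y′≤0 : x′ + y′ ≤ 0ℤ

module _ (x x′ b b′ : ℤ) (s : Spine 0ℤ 1ℤ x x′ b b′) where
  open Spine s

  x′≤b : x′ ≤ b
  x′≤b = ℤ.0≤i-j⇒j≤i (0≤2*⇒0≤ (subst (0ℤ ≤_) (eq x x′ b) (slack x′≤₁)))
    where
    eq : ∀ x x′ b → + 2 * (1ℤ * b) - (+ 2 * x′ + 0ℤ * x) ≡ + 2 * (b - x′)
    eq x x′ b = solve (x ∷ x′ ∷ b ∷ [])

  x′+b′≤-b : x′ + b′ ≤ - b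
  x′+b′≤-b = bySlack (slack x′≤b ⊹ slack b′≤) (solve (x′ ∷ b′ ∷ b ∷ []))

  leafless⇒branch : ∀ y y′ → 0ℤ ≤ y → Leafless x′ b y y′ → Branch x x′ b b′ y y′
  leafless⇒branch y y′ 0≤y l = record
    { 1≤y = 0<2*⇒1≤ (ℤ.≤-trans (ℤ.+-monoʳ-≤ 1ℤ 0≤b) b<2y)
    ; y<x = ℤ.≤-trans y<b b≤x
    ; y≤b = ℤ.≤-trans (ℤ.i≤suc[i] y) y<b
    ; b≤x = b≤x
    ; x′≤x = ℤ.≤-trans x′≤b b≤x
    ; x′+b′≤ = bySlack (0≤y ⊹ slack x′+b′≤-b) (solve (x′ ∷ b′ ∷ b ∷ y ∷ []))
    ; x′+y′≤0 = x′+y′≤0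
    ; balance = bySlack (slack x′+b′≤-b ⊹ slack x′≤b ⊹ slack b≤x) (solve (x ∷ x′ ∷ b′ ∷ b ∷ []))
    }
    where
    open Leafless l
    0<2*⇒1≤ : ∀ {a} → 1ℤ ≤ + 2 * a → 1ℤ ≤ a
    0<2*⇒1≤ {+ zero} (+≤+ ())
    0<2*⇒1≤ {+[1+ _ ]} _ = +≤+ (s≤s z≤n)

module _ (j p x x′ b b′ : ℤ) (1≤j : 1ℤ ≤ j) (2≤p : + 2 ≤ p) (s : Spine j p x x′ b b′) where
  open Spine s

  private
    2b≤x : + 2 * b ≤ x
    2b≤x = bySlack (slack 2≤p ⊛ 0≤b ⊹ slack pb≤x) (solve (p ∷ b ∷ x ∷ []))

  -- `b` and `b′` stand in the places of `y` and `y′`, since an unchosen root with a leaf child is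
  -- always dominated.
  leafed⇒branch : x′ + b′ ≤ 0ℤ → Branch x x′ b b′ b b′
  leafed⇒branch n≤0 = record
    { 1≤y = 1≤b
    ; y<x = bySlack (slack 2b≤x ⊹ slack 1≤b) (solve (b ∷ x ∷ []))
    ; y≤b = ℤ.≤-refl
    ; b≤x = b≤x
    ; x′≤x = bySlack (slack b+x′≤x ⊹ 0≤b) (solve (x ∷ x′ ∷ b ∷ []))
    ; x′+b′≤ = subst (x′ + b′ ≤_) (sym (ℤ.+-inverseʳ b)) n≤0
    ; x′+y′≤0 = n≤0
    ; balance = bySlack (slack b+x′≤x ⊹ slack n≤0) (solve (x ∷ x′ ∷ b ∷ b′ ∷ []))
    }
    where
    eq : ∀ j p x x′ b →
      (+ 2 * (p * b) - (+ 2 * x′ + j * x)) + + 2 * (x - p * b) + (j - 1ℤ) * x + (x - + 2 * b)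
      ≡ + 2 * (x - (b + x′))
    eq j p x x′ b = solve (j ∷ p ∷ x ∷ x′ ∷ b ∷ [])
    b+x′≤x : b + x′ ≤ x
    b+x′≤x = ℤ.0≤i-j⇒j≤i (0≤2*⇒0≤ (subst (0ℤ ≤_) (eq j p x x′ b)
      (slack x′≤₁ ⊹ 0≤+ {2} ⊛ slack pb≤x ⊹ slack 1≤j ⊛ 0≤x ⊹ slack 2b≤x)))

module _ (x x′ b b′ : ℤ) (s : Spine 1ℤ (+ 2) x x′ b b′) where
  open Spine s

  private
    u≥0 : 0ℤ ≤ + 2 * b - (+ 2 * x′ + (1ℤ - 1ℤ) * x)
    u≥0 = slack x′≤₂
    v≥0 : 0ℤ ≤ + 2 * ((1ℤ - + 2) * b - b′)
    v≥0 = 0≤+ {2} ⊛ slack b′≤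
    eq : ∀ x x′ b b′ →
      (+ 2 * b - (+ 2 * x′ + (1ℤ - 1ℤ) * x)) + + 2 * ((1ℤ - + 2) * b - b′) ≡ + 2 * (0ℤ - (x′ + b′))
    eq x x′ b b′ = solve (x ∷ x′ ∷ b ∷ b′ ∷ [])

  -- For one leaf child `x′≤₂` amounts to x′ ≤ b and `b′≤` to b′ ≤ -b.
  oneLeaf-≤0 : x′ + b′ ≤ 0ℤ
  oneLeaf-≤0 = ℤ.0≤i-j⇒j≤i (0≤2*⇒0≤ (subst (0ℤ ≤_) (eq x x′ b b′) (u≥0 ⊹ v≥0)))

  oneLeaf-tight : x′ + b′ ≡ 0ℤ → Tight 1ℤ (+ 2) x x′ b b′
  oneLeaf-tight n≡0 = +≡0⇒≡0ˡ u≥0 v≥0 (trans (eq x x′ b b′) (cong (λ z → + 2 * (0ℤ - z)) n≡0))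

module _ (i q x x′ b b′ : ℤ) (0≤i : 0ℤ ≤ i) (1≤q : 1ℤ ≤ q)
         (s : Spine (+ 2 + i) (+ 2 * (+ 2 * q)) x x′ b b′) where
  open Spine s

  private
    2b<x : 1ℤ ≤ x - + 2 * b
    2b<x = bySlack (slack pb≤x ⊹ 0≤+ {4} ⊛ slack 1≤q ⊛ 0≤b ⊹ 0≤+ {2} ⊛ slack 1≤b ⊹ 0≤+ {1})
                   (solve (q ∷ b ∷ x ∷ []))
    u≥0 : 0ℤ ≤ + 2 * (+ 2 * q) * b - (+ 2 * x′ + (+ 2 + i - 1ℤ) * x)
    u≥0 = slack x′≤₂
    v≥0 : 0ℤ ≤ + 2 * ((+ 2 + i - + 2) * b - b′) + (x - + 2 * (+ 2 * q) * b)
    v≥0 = 0≤+ {2} ⊛ slack b′≤ ⊹ slack pb≤x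
    w≥0 : 0ℤ ≤ (x - + 2 * b) * i
    w≥0 = 1≤⇒0≤ 2b<x ⊛ 0≤i
    eq : ∀ i q x x′ b b′ →
      (+ 2 * (+ 2 * q) * b - (+ 2 * x′ + (+ 2 + i - 1ℤ) * x))
      + (+ 2 * ((+ 2 + i - + 2) * b - b′) + (x - + 2 * (+ 2 * q) * b))
      + (x - + 2 * b) * i ≡ + 2 * (0ℤ - (x′ + b′))
    eq i q x x′ b b′ = solve (i ∷ q ∷ x ∷ x′ ∷ b ∷ b′ ∷ [])

  -- Each of the i leaf children beyond the second costs x - 2b > 0. This term is what excludes
  -- three leaf children in the equality case.
  moreLeaves-≤0 : x′ + b′ ≤ 0ℤ
  moreLeaves-≤0 = ℤ.0≤i-j⇒j≤i (0≤2*⇒0≤ (subst (0ℤ ≤_) (eq i q x x′ b b′) (u≥0 ⊹ v≥0 ⊹ w≥0)))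

  moreLeaves-tight : x′ + b′ ≡ 0ℤ → Tight (+ 2 + i) (+ 2 * (+ 2 * q)) x x′ b b′ × i ≡ 0ℤ
  moreLeaves-tight n≡0 = +≡0⇒≡0ˡ u≥0 v≥0 (+≡0⇒≡0ˡ (u≥0 ⊹ v≥0) w≥0 sum≡0)
                       , *≡0⇒≡0ʳ 2b<x (+≡0⇒≡0ʳ (u≥0 ⊹ v≥0) w≥0 sum≡0)
    where sum≡0 = trans (eq i q x x′ b b′) (cong (λ z → + 2 * (0ℤ - z)) n≡0)

exact-oneLeaf : ∀ x x′ b b′ → Exact 1ℤ (+ 2) x x′ b b′ → x′ + b′ ≡ 0ℤ
exact-oneLeaf x x′ b b′ record { x≡ = refl ; x′≡ = x′≡ ; b′≡ = refl } =
  2*-injective (trans (via (cong (_- + 2 * b) x′≡) (solve (x′ ∷ b ∷ []))) (solve (b ∷ [])))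

exact-twoLeaves : ∀ p x x′ b b′ → Exact (+ 2) p x x′ b b′ → x′ + b′ ≡ 0ℤ
exact-twoLeaves p x x′ b b′ record { x≡ = refl ; x′≡ = x′≡ ; b′≡ = refl } =
  cong (_+ 0ℤ) (2*-injective {b = 0ℤ} x′≡)

module _ (X X′ B B′ Y Y′ : ℤ) (c : Branch X X′ B B′ Y Y′) where

  private module C = Branch c

  -- For a root whose only child is this branch, `balance` of the child is the bound on x′ + y′,
  -- `y<x` gives `b<2y`, and `x′≤x` gives `y′≤-y`.
  leafless-first : Leafless (1ℤ * (X + B) + 1ℤ * (X′ + B′)) (1ℤ * (X + Y))
                            (1ℤ * X + 0ℤ * Y) ((- + 2) * X + 1ℤ * X′ + (0ℤ * Y + 0ℤ * Y′))
  leafless-first = record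
    { y<b = bySlack (slack C.1≤y) (solve (X ∷ Y ∷ []))
    ; b<2y = bySlack (slack C.y<x) (solve (X ∷ Y ∷ []))
    ; y′≤-y = bySlack (slack C.x′≤x) (solve (X ∷ X′ ∷ Y ∷ Y′ ∷ []))
    ; x′+y′≤0 = bySlack (slack C.balance) (solve (X ∷ X′ ∷ B ∷ B′ ∷ Y ∷ Y′ ∷ []))
    }

  module _ (x x′ b b′ y y′ : ℤ) (s : Spine 0ℤ 1ℤ x x′ b b′) (0≤y : 0ℤ ≤ y) (l : Leafless x′ b y y′) where

    private
      module S = Spine s
      module L = Leafless l

    -- A further non-leaf child makes the bound strict. Since x′ ≤ b still holds, x′ + y′ < 0
    -- follows, so equality cannot occur at a root with several children and no leaf among them.
    y′<-b : 1ℤ + (b′ * X + b * X′ + (y′ * Y + y * Y′)) ≤ - (b * (X + Y))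
    y′<-b = bySlack
      (slack S.b′≤ ⊛ C.0≤x ⊹ slack L.y′≤-y ⊛ C.0≤y ⊹ 0≤y ⊛ slack C.x′+y′≤0
        ⊹ (0≤+ {1} ⊹ slack L.y<b) ⊛ slack C.x′≤x
        ⊹ 0≤y ⊛ slack C.y<x ⊹ 0≤y ⊹ slack C.1≤y ⊹ slack L.b<2y ⊛ C.0≤y)
      (solve (b ∷ b′ ∷ y ∷ y′ ∷ X ∷ X′ ∷ Y ∷ Y′ ∷ []))

    x′+y′<0 : 1ℤ + (x′ * (X + B) + x * (X′ + B′) + (b′ * X + b * X′ + (y′ * Y + y * Y′))) ≤ 0ℤ
    x′+y′<0 = bySlack (slack y′<-b ⊹ slack (x′≤b _ _ _ _ (spine-branch _ _ _ _ _ _ _ _ _ _ _ _ s c)))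
      (solve (x ∷ x′ ∷ b ∷ b′ ∷ y ∷ y′ ∷ X ∷ X′ ∷ B ∷ B′ ∷ Y ∷ Y′ ∷ []))

    leafless-next : Leafless (x′ * (X + B) + x * (X′ + B′)) (b * (X + Y))
                             (b * X + y * Y) (b′ * X + b * X′ + (y′ * Y + y * Y′))
    leafless-next = record
      { y<b = bySlack (slack L.y<b ⊛ C.0≤y ⊹ slack C.1≤y) (solve (b ∷ y ∷ X ∷ Y ∷ []))
      ; b<2y = bySlack (S.0≤b ⊛ slack C.y<x ⊹ slack S.1≤b ⊹ 0≤+ {2} ⊛ 0≤y ⊛ C.0≤y)
                       (solve (b ∷ y ∷ X ∷ Y ∷ []))
      ; y′≤-y = bySlack (slack y′<-b ⊹ 0≤+ {1} ⊹ (0≤+ {1} ⊹ slack L.y<b) ⊛ C.0≤y)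
                        (solve (b ∷ b′ ∷ y ∷ y′ ∷ X ∷ X′ ∷ Y ∷ Y′ ∷ []))
      ; x′+y′≤0 = ℤ.≤-trans (ℤ.i≤suc[i] _) x′+y′<0
      }

-- The dual numbers and the induction over rooted trees

dualSemiring : CommutativeSemiring 0ℓ 0ℓ
dualSemiring = record
  { Carrier = ℤ × ℤ
  ; _≈_ = _≡_
  ; _+_ = λ (a , a′) (b , b′) → a + b , a′ + b′
  ; _*_ = λ (a , a′) (b , b′) → a * b , a′ * b + a * b′
  ; 0# = 0ℤ , 0ℤ
  ; 1# = 1ℤ , 0ℤ
  ; isCommutativeSemiring = isCommutativeSemiringˡ record
    { +-isCommutativeMonoid = record
      { isMonoid = record
        { isSemigroup = record
          { isMagma = record { isEquivalence = isEquivalence ; ∙-cong = cong₂ _ }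
          ; assoc = λ { (a , a′) (b , b′) (c , c′) → cong₂ _,_ (ℤ.+-assoc a b c) (ℤ.+-assoc a′ b′ c′) } }
        ; identity = (λ { (a , a′) → cong₂ _,_ (ℤ.+-identityˡ a) (ℤ.+-identityˡ a′) })
                   , (λ { (a , a′) → cong₂ _,_ (ℤ.+-identityʳ a) (ℤ.+-identityʳ a′) }) }
      ; comm = λ { (a , a′) (b , b′) → cong₂ _,_ (ℤ.+-comm a b) (ℤ.+-comm a′ b′) } }
    ; *-isCommutativeMonoid = record
      { isMonoid = record
        { isSemigroup = record
          { isMagma = record { isEquivalence = isEquivalence ; ∙-cong = cong₂ _ }
          ; assoc = λ { (a , a′) (b , b′) (c , c′) → cong₂ _,_ (ℤ.*-assoc a b c)
                      (solve (a ∷ a′ ∷ b ∷ b′ ∷ c ∷ c′ ∷ [])) } }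
        ; identity = (λ { (a , a′) → cong₂ _,_ (ℤ.*-identityˡ a) (solve (a ∷ a′ ∷ [])) })
                   , (λ { (a , a′) → cong₂ _,_ (ℤ.*-identityʳ a) (solve (a ∷ a′ ∷ [])) }) }
      ; comm = λ { (a , a′) (b , b′) → cong₂ _,_ (ℤ.*-comm a b) (solve (a ∷ a′ ∷ b ∷ b′ ∷ [])) } }
    ; distribʳ = λ { (a , a′) (b , b′) (c , c′) → cong₂ _,_ (ℤ.*-distribʳ-+ a b c)
                   (solve (a ∷ a′ ∷ b ∷ b′ ∷ c ∷ c′ ∷ [])) }
    ; zeroˡ = λ { (a , a′) → cong₂ _,_ (ℤ.*-zeroˡ a) (solve (a ∷ a′ ∷ [])) }
    }
  }

chosen skipped : ℤ × ℤ
chosen  = 1ℤ , 1ℤ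
skipped = 1ℤ , - + 2

module Dual = RootedWeights dualSemiring chosen skipped

x x′ b b′ y y′ : Rooted → ℤ
x t = proj₁ (Dual.X t)
x′ t = proj₂ (Dual.X t)
b t = proj₁ (Dual.B t)
b′ t = proj₂ (Dual.B t)
y t = proj₁ (Dual.Y t)
y′ t = proj₂ (Dual.Y t)

2^_ : ℕ → ℤ
2^ zero  = 1ℤ
2^ suc n = + 2 * (2^ n)

1≤2^ : ∀ n → 1ℤ ≤ 2^ n
1≤2^ zero    = ℤ.≤-refl
1≤2^ (suc n) = ℤ.≤-trans (1≤2^ n) (bySlack (1≤⇒0≤ (1≤2^ n)) (eq (2^ n)))
  where
  eq : ∀ p → + 2 * p - p ≡ p
  eq p = solve (p ∷ [])

IsBranch : Rooted → Set
IsBranch t = Branch (x t) (x′ t) (b t) (b′ t) (y t) (y′ t)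

IsSpine : ℕ → Rooted → Set
IsSpine j t = Spine (+ j) (2^ j) (x t) (x′ t) (b t) (b′ t)

-- If the root is not chosen, a leaf child must be chosen to be dominated, and so dominates the
-- root: hence Y = B when there is a leaf child. Strictness in `leafless` starts at two children,
-- because a root with one child is itself a leaf, and equality can then occur, as for the path on
-- three vertices rooted at an end.
data Kind (t : Rooted) : Set where
  bare     : t ≡ • → Kind t
  leafed   : 1 ℕ.≤ leaves t → y t ≡ b t → y′ t ≡ b′ t → Kind t
  leafless : leaves t ≡ 0 → 1 ℕ.≤ children t → Leafless (x′ t) (b t) (y t) (y′ t) →
             (2 ℕ.≤ children t → 1ℤ + (x′ t + y′ t) ≤ 0ℤ) → Kind t

-- `tight⇒` and `⇒exact` are the two directions of the equality case: a single vanishing slack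
-- already forces the support condition, which in turn gives all equalities.
record Invariant (t : Rooted) : Set where
  field
    spine     : IsSpine (leaves t) t
    tight⇒    : Tight (+ leaves t) (2^ leaves t) (x t) (x′ t) (b t) (b′ t) → Supported t
    ⇒exact    : Supported t → Exact (+ leaves t) (2^ leaves t) (x t) (x′ t) (b t) (b′ t)
    0≤y       : 0ℤ ≤ y t
    kind      : Kind t

leafed-≤0 : ∀ j t → 1 ℕ.≤ j → IsSpine j t → x′ t + b′ t ≤ 0ℤ
leafed-≤0 1             t _ s = oneLeaf-≤0 _ _ _ _ s
leafed-≤0 (suc (suc i)) t _ s = moreLeaves-≤0 (+ i) (2^ i) _ _ _ _ 0≤+ (1≤2^ i) s

leafed-tight : ∀ j t → 1 ℕ.≤ j → IsSpine j t → x′ t + b′ t ≡ 0ℤ →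
  Tight (+ j) (2^ j) (x t) (x′ t) (b t) (b′ t) × OneOrTwo j
leafed-tight 1             t _ s h = oneLeaf-tight _ _ _ _ s h , s≤s z≤n , s≤s z≤n
leafed-tight (suc (suc i)) t _ s h =
  proj₁ tight×i≡0 , s≤s z≤n , s≤s (s≤s (ℕ.≤-reflexive (ℤ.+-injective (proj₂ tight×i≡0))))
  where tight×i≡0 = moreLeaves-tight (+ i) (2^ i) (x t) (x′ t) (b t) (b′ t) 0≤+ (1≤2^ i) s h

exact⇒≡0 : ∀ j t → OneOrTwo j → Exact (+ j) (2^ j) (x t) (x′ t) (b t) (b′ t) → x′ t + b′ t ≡ 0ℤ
exact⇒≡0 1 t _ e = exact-oneLeaf _ _ _ _ e
exact⇒≡0 2 t _ e = exact-twoLeaves _ _ _ _ _ e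
exact⇒≡0 (suc (suc (suc _))) t (_ , s≤s (s≤s ())) e

leafed⇒isBranch : ∀ t → 1 ℕ.≤ leaves t → IsSpine (leaves t) t → y t ≡ b t → y′ t ≡ b′ t → IsBranch t
leafed⇒isBranch t 1≤j s eq eq′ = subst₂ (Branch (x t) (x′ t) (b t) (b′ t)) (sym eq) (sym eq′)
  (leafed⇒branch (+ leaves t) (2^ leaves t) _ _ _ _ (+≤+ 1≤j) (2≤2^ (leaves t) 1≤j) s
    (leafed-≤0 (leaves t) t 1≤j s))
  where
  2≤2^ : ∀ j → 1 ℕ.≤ j → + 2 ≤ 2^ j
  2≤2^ (suc j) _ = ℤ.*-monoˡ-≤-nonNeg (+ 2) (1≤2^ j)

module _ {t : Rooted} (inv : Invariant t) (1≤k : 1 ℕ.≤ children t) where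
  open Invariant inv

  isBranch : IsBranch t
  isBranch with kind
  ... | bare refl = case 1≤k of λ ()
  ... | leafed 1≤j eq eq′ = leafed⇒isBranch t 1≤j spine eq eq′
  ... | leafless j≡0 _ l _ = leafless⇒branch _ _ _ _ (subst (λ j → IsSpine j t) j≡0 spine) _ _ 0≤y l

  balanced⇒supported : x′ t + b′ t ≡ 0ℤ → OneOrTwo (leaves t) × Supported t
  balanced⇒supported h with kind
  ... | bare refl = case 1≤k of λ ()
  ... | leafed 1≤j _ _ = let tight , j≤2 = leafed-tight (leaves t) t 1≤j spine h in j≤2 , tight⇒ tight
  -- Without leaf children x′ + b′ ≤ -b < 0.
  ... | leafless j≡0 _ _ _ = ⊥-elim (1≰0 (ℤ.≤-trans (Spine.1≤b spine) (ℤ.neg-cancel-≤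
    (subst (_≤ - b t) h (x′+b′≤-b _ _ _ _ (subst (λ j → IsSpine j t) j≡0 spine))))))

  supported⇒balanced : OneOrTwo (leaves t) → Supported t → x′ t + b′ t ≡ 0ℤ × y t ≡ b t × y′ t ≡ b′ t
  supported⇒balanced j≤2 h with kind
  ... | bare refl = case 1≤k of λ ()
  ... | leafed 1≤j eq eq′ = exact⇒≡0 (leaves t) t j≤2 (⇒exact h) , eq , eq′
  ... | leafless j≡0 _ _ _ = case subst (1 ℕ.≤_) j≡0 (proj₁ j≤2) of λ ()

module _ {r : Rooted} (inv : Invariant r) where
  open Invariant inv

  invariant-leaf : Invariant (r ◁ •)
  invariant-leaf = record
    { spine  = spine-leaf _ _ _ _ _ _ spine
    ; tight⇒ = λ h → tight⇒ (tight-leaf (+ leaves r) (2^ leaves r) (x r) (x′ r) (b r) (b′ r) h)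
                   , tt , λ 0≢0 → ⊥-elim (0≢0 refl)
    ; ⇒exact = λ (h , _) → exact-leaf _ _ _ _ _ _ (⇒exact h)
    ; 0≤y    = Spine.0≤b spine ⊛ 0≤+ {1} ⊹ 0≤y ⊛ 0≤+ {0}
    ; kind   = leafed (s≤s z≤n) (eq (b r) (y r)) (eq′ (b r) (b′ r) (y r) (y′ r))
    }
    where
    eq : ∀ b y → b * 1ℤ + y * 0ℤ ≡ b * 1ℤ
    eq b y = solve (b ∷ y ∷ [])
    eq′ : ∀ b b′ y y′ → (b′ * 1ℤ + b * 1ℤ) + (y′ * 0ℤ + y * 0ℤ) ≡ b′ * 1ℤ + b * 1ℤ
    eq′ b b′ y y′ = solve (b ∷ b′ ∷ y ∷ y′ ∷ [])

  invariant-branch : ∀ {c d} → Invariant (c ◁ d) → Invariant (r ◁ (c ◁ d))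
  invariant-branch {c} {d} inv′ = record
    { spine  = spine-branch _ _ _ _ _ _ _ _ _ _ _ _ spine br
    ; tight⇒ = λ h → let tight , bal = tight-branch _ _ _ _ _ _ _ _ _ _ _ _ spine br h
                         j≤2 , sup = balanced⇒supported inv′ 1≤k bal
                     in tight⇒ tight , sup , λ _ → j≤2
    ; ⇒exact = λ (h , sup , good) →
        let bal , eq , eq′ = supported⇒balanced inv′ 1≤k (good λ ()) sup
        in exact-branch _ _ _ _ _ _ (x s) (x′ s) (b s) (b′ s) (y s) (y′ s) (⇒exact h) eq eq′ bal
    ; 0≤y    = Spine.0≤b spine ⊛ Branch.0≤x br ⊹ 0≤y ⊛ Branch.0≤y br
    ; kind   = kind′ kind
    }
    where
    s : Rooted
    s = c ◁ d
    1≤k : 1 ℕ.≤ children (c ◁ d)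
    1≤k = s≤s z≤n
    br : IsBranch (c ◁ d)
    br = isBranch inv′ 1≤k
    eq : ∀ b X Y → b * X + b * Y ≡ b * (X + Y)
    eq b X Y = solve (b ∷ X ∷ Y ∷ [])
    eq′ : ∀ b b′ X X′ Y Y′ → (b′ * X + b * X′) + (b′ * Y + b * Y′) ≡ b′ * (X + Y) + b * (X′ + Y′)
    eq′ b b′ X X′ Y Y′ = solve (b ∷ b′ ∷ X ∷ X′ ∷ Y ∷ Y′ ∷ [])
    kind′ : Kind r → Kind (r ◁ s)
    kind′ (bare refl) = leafless refl (s≤s z≤n) (leafless-first _ _ _ _ _ _ br) λ { (s≤s ()) }
    kind′ (leafed 1≤j y≡b y′≡b′) = leafed 1≤j
      (trans (cong (λ z → b r * x s + z * y s) y≡b) (eq (b r) (x s) (y s)))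
      (trans (cong₂ (λ z z′ → (b′ r * x s + b r * x′ s) + (z′ * y s + z * y′ s)) y≡b y′≡b′)
             (eq′ (b r) (b′ r) (x s) (x′ s) (y s) (y′ s)))
    kind′ (leafless j≡0 _ l _) = leafless j≡0 (s≤s z≤n)
      (leafless-next _ _ _ _ _ _ br _ _ _ _ _ _ (subst (λ j → IsSpine j r) j≡0 spine) 0≤y l)
      λ _ → x′+y′<0 _ _ _ _ _ _ br _ _ _ _ _ _ (subst (λ j → IsSpine j r) j≡0 spine) 0≤y l

invariant : ∀ t → Invariant t
invariant • = record
  { spine = spine-• ; tight⇒ = λ _ → tt ; ⇒exact = λ _ → exact-• ; 0≤y = ℤ.≤-refl ; kind = bare refl }
invariant (r ◁ •) = invariant-leaf (invariant r)
invariant (r ◁ (c ◁ d)) = invariant-branch (invariant r) (invariant (c ◁ d))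

-- In a dominating set of the whole tree the root is chosen or dominated by a child, so the total
-- weight is X + Y.
excess : Rooted → ℤ
excess t = x′ t + y′ t

excess≤0 : ∀ t → 1 ℕ.≤ children t → excess t ≤ 0ℤ
excess≤0 t 1≤k = Branch.x′+y′≤0 (isBranch (invariant t) 1≤k)

-- Two children make the root a non-leaf, so the support condition applies to it too. With a leaf
-- child y′ = b′, which reduces the claim to x′ + b′; without one the excess is negative.
excess≡0⇔ : ∀ t → 2 ℕ.≤ children t → excess t ≡ 0ℤ ⇔ (OneOrTwo (leaves t) × Supported t)
excess≡0⇔ t 2≤k = mk⇔ to from
  where
  inv : Invariant t
  inv = invariant t
  1≤k : 1 ℕ.≤ children t
  1≤k = ℕ.≤-trans (s≤s z≤n) 2≤k
  to : excess t ≡ 0ℤ → OneOrTwo (leaves t) × Supported t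
  to h with Invariant.kind inv
  ... | bare refl = case 2≤k of λ ()
  ... | leafed _ _ eq′ = balanced⇒supported inv 1≤k (trans (cong (λ z → x′ t + z) (sym eq′)) h)
  ... | leafless _ _ _ <0 = ⊥-elim (1≰0 (subst (λ z → 1ℤ + z ≤ 0ℤ) h (<0 2≤k)))
  from : OneOrTwo (leaves t) × Supported t → excess t ≡ 0ℤ
  from (j≤2 , sup) = let bal , _ , eq′ = supported⇒balanced inv 1≤k j≤2 sup
                     in trans (cong (λ z → x′ t + z) eq′) bal

-- Pruning a leaf of a graph

open import Data.Bool using (Bool; true; false; T; T?; _∧_; _∨_)
import Data.Bool.Properties as Bool
open import Data.Fin as Fin using (Fin; zero; suc; punchIn; punchOut)
open import Data.Fin.Properties as Fin using (any?; punchIn-punchOut; punchInᵢ≢i; punchIn-injective)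
open import Data.Fin.Subset using (Subset; ∣_∣)
open import Data.List.Membership.Propositional using () renaming (_∈_ to _∈ˡ_)
open import Data.List.Membership.Propositional.Properties using (∈-lookup)
import Data.List.Properties as List
open import Data.List.Relation.Unary.All as All using (All; []; _∷_)
open import Data.List.Relation.Unary.All.Properties using (¬Any⇒All¬)
open import Data.List.Relation.Unary.AllPairs using ([]; _∷_)
open import Data.List.Relation.Unary.Any using (here; there)
open import Data.List.Relation.Unary.Linked using (Linked; [-]; _∷_)
import Data.List.Relation.Unary.Linked.Properties as Linked
open import Data.List.Relation.Unary.Unique.Propositional using (Unique)
import Data.List.Relation.Unary.Unique.Propositional.Properties as Unique
open import Data.Maybe as Maybe using (just)
open import Data.Nat.ListAction using (sum)
open import Data.Vec using ([]; _∷_; lookup; insertAt)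
open import Data.Vec.Functional using (updateAt)
open import Data.Vec.Functional.Properties using (updateAt-updates; updateAt-minimal)
open import Data.Vec.Properties using (insertAt-lookup; insertAt-punchIn; []=⇒lookup; lookup⇒[]=)
open import Relation.Binary.Construct.Closure.ReflexiveTransitive using (Star; ε; _◅_)

Adj-sym : ∀ {n} (G : Graph n) {u v} → Adj G u v → Adj G v u
Adj-sym G {u} {v} = subst T (Defs.sym G u v)

Adj⇒≢ : ∀ {n} (G : Graph n) {u v} → Adj G u v → u ≢ v
Adj⇒≢ G {u} u~u refl = subst T (irref G u) u~u

Unique⇒length≤ : ∀ {n} {xs : List (Fin n)} → Unique xs → length xs ℕ.≤ n
Unique⇒length≤ uniq = Fin.injective⇒≤ (lookup-injective uniq)
  where
  lookup-injective : ∀ {n} {xs : List (Fin n)} → Unique xs →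
    ∀ {i j} → List.lookup xs i ≡ List.lookup xs j → i ≡ j
  lookup-injective (x∉ ∷ u) {zero} {zero} eq = refl
  lookup-injective (x∉ ∷ u) {zero} {suc j} eq = ⊥-elim (All.lookup x∉ (∈-lookup j) eq)
  lookup-injective (x∉ ∷ u) {suc i} {zero} eq = ⊥-elim (All.lookup x∉ (∈-lookup i) (sym eq))
  lookup-injective (x∉ ∷ u) {suc i} {suc j} eq = cong suc (lookup-injective u eq)

-- Cutting a path at its vertex u leaves a path ending in u, ready to be closed to a cycle. The
-- quantified `P` transfers distinctness from the vertices in front of the path to its prefix.
prefixTo : ∀ {n} (G : Graph n) {u} {xs : List (Fin n)} → u ∈ˡ xs → Unique xs → ∃ λ ys →
  Unique ys × (∀ {P : Fin n → Set} → All P xs → All P ys) × 1 ℕ.≤ length ys ×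
  (∀ {v} → Linked (Adj G) (v ∷ xs) → Linked (Adj G) (v ∷ ys) × last (v ∷ ys) ≡ just u)
prefixTo _ {u} (here refl) _ =
  u ∷ [] , [] ∷ [] , (λ { (p ∷ _) → p ∷ [] }) , s≤s z≤n , λ { (e ∷ _) → e ∷ [-] , refl }
prefixTo G {xs = x ∷ _} (there u∈) (x∉ ∷ uniq) =
  let ys , uniq′ , all , _ , linked = prefixTo G u∈ uniq in
  x ∷ ys , all x∉ ∷ uniq′ , (λ { (p ∷ ps) → p ∷ all ps }) , s≤s z≤n ,
  λ { (e ∷ es) → let es′ , last≡ = linked es in e ∷ es′ , last≡ }

-- By anchored, r is not a leaf itself unless it is the root ρ.
record PendantEdge {n} (G : Graph n) (ρ c r : Fin n) : Set where
  field
    c≢ρ      : c ≢ ρ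
    c~r      : Adj G c r
    only     : ∀ {u} → Adj G c u → u ≡ r
    anchored : r ≡ ρ ⊎ (∃ λ w → w ≢ c × Adj G r w)

last∈ : ∀ {A : Set} {v : A} xs → last xs ≡ just v → v ∈ˡ xs
last∈ (_ ∷ []) refl = here refl
last∈ (_ ∷ x ∷ xs) eq = there (last∈ (x ∷ xs) eq)

-- A path ending at ρ is prolonged at its other end until that end has no
-- second neighbour; a chord back to the path would close a cycle.
prolong : ∀ {n} (G : Graph n) (ρ : Fin n) → Acyclic G → ∀ fuel {v w vs} →
  n ℕ.< length (v ∷ w ∷ vs) ℕ.+ fuel →
  Linked (Adj G) (v ∷ w ∷ vs) → Unique (v ∷ w ∷ vs) → last (w ∷ vs) ≡ just ρ →
  ∃ λ c → ∃ λ r → PendantEdge G ρ c r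
-- Out of fuel, the path would have more than n distinct vertices.
prolong {n} G ρ acyclic zero bound _ uniq _ =
  ⊥-elim (ℕ.<⇒≱ (subst (n ℕ.<_) (ℕ.+-identityʳ _) bound) (Unique⇒length≤ uniq))
prolong {n} G ρ acyclic (suc fuel) {v} {w} {vs} bound
  linked@(v~w ∷ linked′) uniq@(v∉@(v≢w ∷ v∉vs) ∷ (w∉ ∷ uniq′)) last≡
  with any? (λ u → T? (adj G v u) ×-dec ¬? (u Fin.≟ w))
... | yes (u , v~u , u≢w) = prolong G ρ acyclic fuel
        (subst (n ℕ.<_) (ℕ.+-suc _ fuel) bound)
        (Adj-sym G v~u ∷ linked) (((Adj⇒≢ G v~u ∘ sym) ∷ u≢w ∷ ¬Any⇒All¬ vs u∉vs) ∷ uniq) last≡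
  where
  u∉vs : ¬ u ∈ˡ vs
  u∉vs u∈ with prefixTo G u∈ uniq′
  ... | ys , uniqys , all , 1≤ , linkedys =
    let linked″ , last≡u = linkedys linked′
    in acyclic (v ∷ w ∷ ys)
         ( s≤s (s≤s 1≤) , (v≢w ∷ all v∉vs) ∷ all w∉ ∷ uniqys , v~w ∷ linked″
         , v , u , refl , last≡u , Adj-sym G v~u)
... | no only = v , w , record
  { c≢ρ = λ { refl → All.lookup v∉ (last∈ _ last≡) refl }
  ; c~r = v~w
  ; only = λ {u} v~u → case u Fin.≟ w of λ { (yes eq) → eq ; (no u≢w) → ⊥-elim (only (u , v~u , u≢w)) }
  ; anchored = anchored vs linked′ v∉vs last≡ }
  where
  anchored : ∀ vs → Linked (Adj G) (w ∷ vs) → All (v ≢_) vs → last (w ∷ vs) ≡ just ρ →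
             w ≡ ρ ⊎ (∃ λ z → z ≢ v × Adj G w z)
  anchored [] _ _ refl = inj₁ refl
  anchored (z ∷ _) (w~z ∷ _) (v≢z ∷ _) _ = inj₂ (z , v≢z ∘ sym , w~z)

-- Walks to the root are the form of connectedness carried through the pruning.
ConnectedTo : ∀ {n} → Graph n → Fin n → Set
ConnectedTo G ρ = ∀ u → Star (Adj G) u ρ

walk⇒star : ∀ {n} (G : Graph n) {u v} ws → IsWalkFromTo G u v ws → Star (Adj G) u v
walk⇒star G (_ ∷ []) ([-] , refl , refl) = ε
walk⇒star G (_ ∷ w ∷ ws) (e ∷ linked , refl , last≡) = e ◅ walk⇒star G (w ∷ ws) (linked , refl , last≡)

connected⇒connectedTo : ∀ {n} (G : Graph n) → Connected G → ∀ ρ → ConnectedTo G ρ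
connected⇒connectedTo G conn ρ u = let ws , walk = conn u ρ in walk⇒star G ws walk

-- The neighbour is the vertex from which the walk first enters ρ.
hasNeighbour : ∀ {n} (G : Graph n) {u ρ} → u ≢ ρ → Star (Adj G) u ρ → ∃ λ v → Adj G v ρ
hasNeighbour G u≢ρ ε = ⊥-elim (u≢ρ refl)
hasNeighbour G {u} {ρ} u≢ρ (_◅_ {j = w} e es) with w Fin.≟ ρ
... | yes refl = u , e
... | no  w≢ρ  = hasNeighbour G w≢ρ es

pendantEdge : ∀ {n} (G : Graph (2 ℕ.+ n)) ρ → Acyclic G → ConnectedTo G ρ →
  ∃ λ c → ∃ λ r → PendantEdge G ρ c r
pendantEdge {n} G ρ acyclic conn =
  let v , v~ρ = hasNeighbour G (punchInᵢ≢i ρ zero) (conn (punchIn ρ zero))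
  -- An edge has two vertices, so fuel `suc n` brings the bound to `3 + n`, just above the order.
  in prolong G ρ acyclic (suc n) ℕ.≤-refl
       (v~ρ ∷ [-]) ((Adj⇒≢ G v~ρ ∷ []) ∷ [] ∷ []) refl

_∖_ : ∀ {n} → Graph (suc n) → Fin (suc n) → Graph n
G ∖ c = record
  { adj   = λ u v → adj G (punchIn c u) (punchIn c v)
  ; sym   = λ u v → Defs.sym G (punchIn c u) (punchIn c v)
  ; irref = λ v → irref G (punchIn c v)
  }

acyclic-∖ : ∀ {n} (G : Graph (suc n)) c → Acyclic G → Acyclic (G ∖ c)
acyclic-∖ G c acyclic vs (3≤ , uniq , linked , a , b , head≡ , last≡ , e) = acyclic (map (punchIn c) vs)
  ( subst (3 ℕ.≤_) (sym (List.length-map (punchIn c) vs)) 3≤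
  , Unique.map⁺ (punchIn-injective c _ _) uniq
  , Linked.map⁺ linked
  , punchIn c a , punchIn c b
  , trans (List.head-map vs) (cong (Maybe.map (punchIn c)) head≡)
  , trans (List.last-map (punchIn c) vs) (cong (Maybe.map (punchIn c)) last≡)
  , e )

-- A walk that steps into the pendant vertex c comes from r and returns to r, so the detour can be
-- cut out.
connectedTo-∖ : ∀ {n} {G : Graph (suc n)} {ρ c r} → PendantEdge G (punchIn c ρ) c r →
  ConnectedTo G (punchIn c ρ) → ConnectedTo (G ∖ c) ρ
connectedTo-∖ {G = G} {ρ} {c} {r} edge conn u = bypass u (conn (punchIn c u)) refl
  where
  open PendantEdge edge
  bypass : ∀ u {v} → Star (Adj G) v (punchIn c ρ) → v ≡ punchIn c u → Star (Adj (G ∖ c)) u ρ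
  bypass u ε eq = subst (λ z → Star (Adj (G ∖ c)) z ρ) (punchIn-injective c ρ u eq) ε
  bypass u (_◅_ {j = w} e es) refl with c Fin.≟ w
  ... | no c≢w = subst (Adj G (punchIn c u)) (sym (punchIn-punchOut c≢w)) e
                 ◅ bypass (punchOut c≢w) es (sym (punchIn-punchOut c≢w))
  bypass u (e ◅ ε) refl | yes c≡ = ⊥-elim (c≢ρ c≡)
  bypass u (e ◅ e′ ◅ es) refl | yes refl = bypass u es (trans (only e′) (sym (only (Adj-sym G e))))

-- Weights of graphs with rooted trees attached

open CommutativeMonoidSum Bool.∨-commutativeMonoid using ()
  renaming (sum to ⋁; sum-remove to ⋁-remove; sum-cong-≗ to ⋁-cong; sum-replicate-zero to ⋁-zero)
open CommutativeMonoidSum ℕ.+-0-commutativeMonoid using ()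
  renaming (sum to ∑; sum-remove to ∑-remove; sum-cong-≗ to ∑-cong; sum-replicate-zero to ∑-zero)

dominated : ∀ {n} → Graph n → Subset n → Fin n → Bool
dominated G S v = ⋁ λ u → lookup S u ∧ adj G u v

graft : ∀ {n} → (Fin (suc n) → Rooted) → Fin (suc n) → Fin n → Fin n → Rooted
graft t c r = updateAt (t ∘ punchIn c) r (_◁ t c)

graft-at : ∀ {n} (t : Fin (suc n) → Rooted) c r → graft t c r r ≡ t (punchIn c r) ◁ t c
graft-at t c r = updateAt-updates r (t ∘ punchIn c)

graft-off : ∀ {n} (t : Fin (suc n) → Rooted) c {r v} → v ≢ r → graft t c r v ≡ t (punchIn c v)
graft-off t c {r} {v} = updateAt-minimal v r (t ∘ punchIn c)

-- A Boolean form of the pendant edge in which r is indexed as a vertex of the pruned graph.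
Pendant : ∀ {n} → Graph (suc n) → Fin (suc n) → Fin n → Set
Pendant G c r = adj G c (punchIn c r) ≡ true × (∀ v → v ≢ r → adj G c (punchIn c v) ≡ false)

module DominationWeights {a ℓ} (R : CommutativeSemiring a ℓ)
                         (w₁ w₀ : CommutativeSemiring.Carrier R) where
  open CommutativeSemiring R hiding (zero; sym)
    renaming (_+_ to _⊕_; _*_ to _⊗_; refl to ≈-refl; trans to ≈-trans)
  open CommutativeMonoidSum *-commutativeMonoid using ()
    renaming (sum to ∏; sum-remove to ∏-remove; sum-cong-≋ to ∏-cong)
  open RootedWeights R w₁ w₀
  open SetoidReasoning setoid
  open CommutativeSemigroupProperties (CommutativeMonoid.commutativeSemigroup +-commutativeMonoid)
    using (interchange)
  open CommutativeSemigroupProperties (CommutativeMonoid.commutativeSemigroup *-commutativeMonoid)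
    using (x∙yz≈yx∙z)

  ∑ₛ : ∀ {n} → (Subset n → Carrier) → Carrier
  ∑ₛ {zero}  f = f []
  ∑ₛ {suc n} f = ∑ₛ λ S → f (false ∷ S) ⊕ f (true ∷ S)

  ∑ₛ-cong : ∀ {n} {f g : Subset n → Carrier} → (∀ S → f S ≈ g S) → ∑ₛ f ≈ ∑ₛ g
  ∑ₛ-cong {zero}  f≈g = f≈g []
  ∑ₛ-cong {suc n} f≈g = ∑ₛ-cong λ S → +-cong (f≈g (false ∷ S)) (f≈g (true ∷ S))

  ∑ₛ-insertAt : ∀ {n} (f : Subset (suc n) → Carrier) c →
    ∑ₛ f ≈ ∑ₛ λ S → f (insertAt S c false) ⊕ f (insertAt S c true)
  ∑ₛ-insertAt         f zero    = ≈-refl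
  ∑ₛ-insertAt {suc n} f (suc c) = ≈-trans
    (∑ₛ-insertAt (λ S → f (false ∷ S) ⊕ f (true ∷ S)) c)
    (∑ₛ-cong {n} λ S → interchange _ _ _ _)

  -- The last argument tells whether the root is dominated from outside t.
  local : Rooted → Bool → Bool → Carrier
  local t true  _     = X t
  local t false true  = B t
  local t false false = Y t

  -- With every t v glued to v at its root, this is the total weight of the dominating sets of the
  -- resulting graph that meet the vertices of G in S.
  weight : ∀ {n} → Graph n → (Fin n → Rooted) → Subset n → Carrier
  weight G t S = ∏ λ v → local (t v) (lookup S v) (dominated G S v)

  totalWeight : ∀ {n} → Graph n → (Fin n → Rooted) → Carrier
  totalWeight G t = ∑ₛ (weight G t)

  -- The two summands are the states of c, not chosen and chosen. Outside its own tree c is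
  -- dominated exactly when r is chosen (`s`); r is dominated by a chosen c, and otherwise as `d`
  -- says.
  local-◁ : ∀ r c s d P →
    local c false s ⊗ (local r s d ⊗ P) ⊕ local c true s ⊗ (local r s true ⊗ P) ≈ local (r ◁ c) s d ⊗ P
  local-◁ r c true d P = begin
    B c ⊗ (X r ⊗ P) ⊕ X c ⊗ (X r ⊗ P)  ≈⟨ distribʳ _ _ _ ⟨
    (B c ⊕ X c) ⊗ (X r ⊗ P)            ≈⟨ x∙yz≈yx∙z _ _ _ ⟩
    (X r ⊗ (B c ⊕ X c)) ⊗ P            ≈⟨ *-congʳ (*-congˡ (+-comm _ _)) ⟩
    (X r ⊗ (X c ⊕ B c)) ⊗ P            ∎
  local-◁ r c false true P = begin
    Y c ⊗ (B r ⊗ P) ⊕ X c ⊗ (B r ⊗ P)  ≈⟨ distribʳ _ _ _ ⟨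
    (Y c ⊕ X c) ⊗ (B r ⊗ P)            ≈⟨ x∙yz≈yx∙z _ _ _ ⟩
    (B r ⊗ (Y c ⊕ X c)) ⊗ P            ≈⟨ *-congʳ (*-congˡ (+-comm _ _)) ⟩
    (B r ⊗ (X c ⊕ Y c)) ⊗ P            ∎
  local-◁ r c false false P = begin
    Y c ⊗ (Y r ⊗ P) ⊕ X c ⊗ (B r ⊗ P)  ≈⟨ +-cong (x∙yz≈yx∙z _ _ _) (x∙yz≈yx∙z _ _ _) ⟩
    (Y r ⊗ Y c) ⊗ P ⊕ (B r ⊗ X c) ⊗ P  ≈⟨ distribʳ _ _ _ ⟨
    (Y r ⊗ Y c ⊕ B r ⊗ X c) ⊗ P        ≈⟨ *-congʳ (+-comm _ _) ⟩
    (B r ⊗ X c ⊕ Y r ⊗ Y c) ⊗ P        ∎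

  module _ {n} (G : Graph (2 ℕ.+ n)) (t : Fin (2 ℕ.+ n) → Rooted) (c : Fin (2 ℕ.+ n)) (r : Fin (suc n))
           (pendantEdge : Pendant G c r) where
    private
      c~r : adj G c (punchIn c r) ≡ true
      c~r = proj₁ pendantEdge
      c≁ : ∀ v → v ≢ r → adj G c (punchIn c v) ≡ false
      c≁ = proj₂ pendantEdge

    dominated-remove : ∀ S β v → dominated G (insertAt S c β) v ≡
      (β ∧ adj G c v) ∨ ⋁ (λ u → lookup S u ∧ adj G (punchIn c u) v)
    dominated-remove S β v = trans
      (⋁-remove {i = c} (λ u → lookup (insertAt S c β) u ∧ adj G u v))
      (cong₂ _∨_ (cong (_∧ adj G c v) (insertAt-lookup S c β))
                 (⋁-cong λ u → cong (_∧ adj G (punchIn c u) v) (insertAt-punchIn S c β u)))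

    dominated-pendant : ∀ S β → dominated G (insertAt S c β) c ≡ lookup S r
    dominated-pendant S β = trans (dominated-remove S β c) (trans
      (cong₂ _∨_ (trans (cong (β ∧_) (irref G c)) (Bool.∧-zeroʳ β))
        (trans (⋁-remove {i = r} (λ u → lookup S u ∧ adj G (punchIn c u) c))
          (cong₂ _∨_ (trans (cong (lookup S r ∧_) (trans (Defs.sym G _ c) c~r)) (Bool.∧-identityʳ _))
                     (trans (⋁-cong λ u → trans (cong (lookup S (punchIn r u) ∧_)
                                                  (trans (Defs.sym G _ c) (c≁ _ (punchInᵢ≢i r u))))
                                                (Bool.∧-zeroʳ _))
                            (⋁-zero n)))))
      (Bool.∨-identityʳ _))

    -- Only the factors of c and r depend on whether c is chosen; `local-◁` merges them into one
    -- factor for the grafted tree.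
    weight-insertAt : ∀ S → weight G t (insertAt S c false) ⊕ weight G t (insertAt S c true)
                            ≈ weight (G ∖ c) (graft t c r) S
    weight-insertAt S = begin
      weight G t (insertAt S c false) ⊕ weight G t (insertAt S c true)
        ≈⟨ +-cong (split false) (split true) ⟩
      local (t c) false s ⊗ (local (t (punchIn c r)) s d ⊗ P)
        ⊕ local (t c) true s ⊗ (local (t (punchIn c r)) s true ⊗ P)
        ≈⟨ local-◁ (t (punchIn c r)) (t c) s d P ⟩
      local (t (punchIn c r) ◁ t c) s d ⊗ P
        ≈⟨ *-cong (reflexive (cong (λ τ → local τ s d) (graft-at t c r)))
                  (∏-cong λ u → reflexive (cong
                    (λ τ → local τ (lookup S (punchIn r u)) (dominated (G ∖ c) S (punchIn r u)))
                    (graft-off t c (punchInᵢ≢i r u)))) ⟨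
      local (graft t c r r) s d
        ⊗ ∏ (λ u → local (graft t c r (punchIn r u)) (lookup S (punchIn r u)) (dominated (G ∖ c) S (punchIn r u)))
        ≈⟨ ∏-remove (λ v → local (graft t c r v) (lookup S v) (dominated (G ∖ c) S v)) ⟨
      weight (G ∖ c) (graft t c r) S ∎
      where
      s d : Bool
      s = lookup S r
      d = dominated (G ∖ c) S r
      P : Carrier
      P = ∏ λ u → local (t (punchIn c (punchIn r u))) (lookup S (punchIn r u)) (dominated (G ∖ c) S (punchIn r u))
      split : ∀ β → weight G t (insertAt S c β) ≈
        local (t c) β s ⊗ (local (t (punchIn c r)) s (β ∨ d) ⊗ P)
      split β = begin
        weight G t (insertAt S c β)
          ≈⟨ ∏-remove {i = c} (λ v → local (t v) (lookup (insertAt S c β) v) (dominated G (insertAt S c β) v)) ⟩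
        local (t c) (lookup (insertAt S c β) c) (dominated G (insertAt S c β) c)
          ⊗ ∏ (λ v → local (t (punchIn c v)) (lookup (insertAt S c β) (punchIn c v))
                     (dominated G (insertAt S c β) (punchIn c v)))
          ≈⟨ *-cong (reflexive (cong₂ (local (t c)) (insertAt-lookup S c β) (dominated-pendant S β)))
                    (∏-cong λ v → reflexive (cong₂ (local (t (punchIn c v)))
                      (insertAt-punchIn S c β v) (dominated-remove S β (punchIn c v)))) ⟩
        local (t c) β s
          ⊗ ∏ (λ v → local (t (punchIn c v)) (lookup S v) ((β ∧ adj G c (punchIn c v)) ∨ dominated (G ∖ c) S v))
          ≈⟨ *-congˡ (∏-remove {i = r} (λ v →
               local (t (punchIn c v)) (lookup S v) ((β ∧ adj G c (punchIn c v)) ∨ dominated (G ∖ c) S v))) ⟩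
        local (t c) β s ⊗ (local (t (punchIn c r)) s ((β ∧ adj G c (punchIn c r)) ∨ d)
          ⊗ ∏ (λ u → local (t (punchIn c (punchIn r u))) (lookup S (punchIn r u))
                     ((β ∧ adj G c (punchIn c (punchIn r u))) ∨ dominated (G ∖ c) S (punchIn r u))))
          ≈⟨ *-congˡ (*-cong
               (reflexive (cong (λ e → local (t (punchIn c r)) s (e ∨ d))
                 (trans (cong (β ∧_) c~r) (Bool.∧-identityʳ β))))
               (∏-cong λ u → reflexive (cong
                 (λ e → local (t (punchIn c (punchIn r u))) (lookup S (punchIn r u)) (e ∨ dominated (G ∖ c) S (punchIn r u)))
                 (trans (cong (β ∧_) (c≁ _ (punchInᵢ≢i r u))) (Bool.∧-zeroʳ β))))) ⟩
        local (t c) β s ⊗ (local (t (punchIn c r)) s (β ∨ d) ⊗ P) ∎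

    totalWeight-∖ : totalWeight G t ≈ totalWeight (G ∖ c) (graft t c r)
    totalWeight-∖ = ≈-trans (∑ₛ-insertAt (weight G t) c) (∑ₛ-cong {suc n} weight-insertAt)

  totalWeight-single : (G : Graph 1) (t : Fin 1 → Rooted) → totalWeight G t ≈ X (t zero) ⊕ Y (t zero)
  totalWeight-single G t = begin
    Y (t zero) ⊗ 1# ⊕ X (t zero) ⊗ 1#  ≈⟨ +-cong (*-identityʳ _) (*-identityʳ _) ⟩
    Y (t zero) ⊕ X (t zero)            ≈⟨ +-comm _ _ ⟩
    X (t zero) ⊕ Y (t zero)            ∎

-- Collapsing a graph to a rooted tree

ι : Bool → ℕ
ι true  = 1
ι false = 0

term≤∑ : ∀ {n} (f : Fin n → ℕ) i → f i ℕ.≤ ∑ f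
term≤∑ {suc n} f i = ℕ.≤-trans (ℕ.m≤m+n (f i) _) (ℕ.≤-reflexive (sym (∑-remove {i = i} f)))

∑≡0 : ∀ {n} {f : Fin n → ℕ} → (∀ i → f i ≡ 0) → ∑ f ≡ 0
∑≡0 {n} f≡0 = trans (∑-cong f≡0) (∑-zero n)

T⇒≡true : ∀ {β} → T β → β ≡ true
T⇒≡true {true} _ = refl

deg : ∀ {n} → Graph n → Fin n → ℕ
deg G v = ∑ λ u → ι (adj G v u)

2≤deg : ∀ {n} (G : Graph n) {v u w} → w ≢ u → Adj G v u → Adj G v w → 2 ℕ.≤ deg G v
2≤deg {suc n} G {v} {u} {w} w≢u v~u v~w = ℕ.≤-trans
  (ℕ.+-mono-≤ (ℕ.≤-reflexive (sym (cong ι (T⇒≡true v~u))))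
    (ℕ.≤-trans (ℕ.≤-reflexive (sym (cong ι
                 (trans (cong (adj G v) (punchIn-punchOut (w≢u ∘ sym))) (T⇒≡true v~w)))))
               (term≤∑ (λ z → ι (adj G v (punchIn u z))) (punchOut (w≢u ∘ sym)))))
  (ℕ.≤-reflexive (sym (∑-remove {i = u} (λ z → ι (adj G v z)))))

-- Degree and number of leaf neighbours of v in the graph obtained from G by
-- identifying the root of every t u with u.
module _ {n} (G : Graph n) (t : Fin n → Rooted) where

  fullDegree : Fin n → ℕ
  fullDegree v = deg G v ℕ.+ children (t v)

  fullLeaves : Fin n → ℕ
  fullLeaves v = ∑ (λ u → ι (adj G v u ∧ (fullDegree u ≡ᵇ 1))) ℕ.+ leaves (t v)

  -- This interpolates between the support condition on a graph, when all trees are trivial, and the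
  -- condition on a rooted tree, when one vertex is left. `Supported` omits the root of each tree,
  -- whose leaf neighbours may also lie in G.
  FullySupported : Set
  FullySupported = ∀ v → (fullDegree v ≢ 1 → OneOrTwo (fullLeaves v)) × Supported (t v)

module _ {n} (G : Graph (suc n)) (t : Fin (suc n) → Rooted) (c : Fin (suc n)) (r : Fin n)
         (pendantEdge : Pendant G c r) where
  private
    c~r : adj G c (punchIn c r) ≡ true
    c~r = proj₁ pendantEdge
    c≁ : ∀ v → v ≢ r → adj G c (punchIn c v) ≡ false
    c≁ = proj₂ pendantEdge

    ∑-pendant : ∀ (f : Bool → Fin (suc n) → ℕ) → (∀ v → f false v ≡ 0) →
      ∑ (λ v → f (adj G c v) v) ≡ f true (punchIn c r)
    ∑-pendant f f-false = begin
      ∑ (λ v → f (adj G c v) v)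
        ≡⟨ ∑-remove {i = c} (λ v → f (adj G c v) v) ⟩
      f (adj G c c) c ℕ.+ ∑ (λ v → f (adj G c (punchIn c v)) (punchIn c v))
        ≡⟨ cong (ℕ._+ ∑ (λ v → f (adj G c (punchIn c v)) (punchIn c v)))
                (trans (cong (λ β → f β c) (irref G c)) (f-false c)) ⟩
      ∑ (λ v → f (adj G c (punchIn c v)) (punchIn c v))
        ≡⟨ ∑-only r _ (λ v v≢r → trans (cong (λ β → f β (punchIn c v)) (c≁ v v≢r)) (f-false (punchIn c v))) ⟩
      f (adj G c (punchIn c r)) (punchIn c r)
        ≡⟨ cong (λ β → f β (punchIn c r)) c~r ⟩
      f true (punchIn c r) ∎
      where
      open ≡-Reasoning
      ∑-only : ∀ {m} (i : Fin m) (g : Fin m → ℕ) → (∀ v → v ≢ i → g v ≡ 0) → ∑ g ≡ g i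
      ∑-only {suc m} i g g≡0 = trans (∑-remove {i = i} g)
        (trans (cong (g i ℕ.+_) (∑≡0 λ u → g≡0 (punchIn i u) (punchInᵢ≢i i u))) (ℕ.+-identityʳ (g i)))

  fullDegree-pendant : fullDegree G t c ≡ suc (children (t c))
  fullDegree-pendant = cong (ℕ._+ children (t c)) (∑-pendant (λ β _ → ι β) λ _ → refl)

  -- The only neighbour of c in G is r, which by hypothesis is not a leaf, so all leaf neighbours of
  -- c lie in its tree.
  fullLeaves-pendant : fullDegree G t (punchIn c r) ≢ 1 → fullLeaves G t c ≡ leaves (t c)
  fullLeaves-pendant r≢1 = cong (ℕ._+ leaves (t c))
    (trans (∑-pendant (λ β u → ι (β ∧ (fullDegree G t u ≡ᵇ 1))) λ _ → refl) (cong ι (≢⇒≡ᵇ r≢1)))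
    where
    ≢⇒≡ᵇ : ∀ {m k} → m ≢ k → (m ≡ᵇ k) ≡ false
    ≢⇒≡ᵇ {m} {k} m≢k with m ≡ᵇ k in eq
    ... | false = refl
    ... | true  = ⊥-elim (m≢k (ℕ.≡ᵇ⇒≡ m k (subst T (sym eq) tt)))

  fullDegree-∖ : ∀ v → fullDegree (G ∖ c) (graft t c r) v ≡ fullDegree G t (punchIn c v)
  fullDegree-∖ v = sym (trans
    (cong (ℕ._+ children (t (punchIn c v))) (∑-remove {i = c} (λ u → ι (adj G (punchIn c v) u))))
    (rest v))
    where
    rest : ∀ v → ι (adj G (punchIn c v) c) ℕ.+ deg (G ∖ c) v ℕ.+ children (t (punchIn c v))
                 ≡ deg (G ∖ c) v ℕ.+ children (graft t c r v)
    rest v with v Fin.≟ r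
    ... | yes refl rewrite Defs.sym G (punchIn c r) c | c~r | graft-at t c r = sym (ℕ.+-suc _ _)
    ... | no v≢r rewrite Defs.sym G (punchIn c v) c | c≁ v v≢r | graft-off t c v≢r = refl

  -- At r the neighbour c turns into a child; it was a leaf exactly when its tree is `•`, which is
  -- what `pendant` counts.
  fullLeaves-∖ : ∀ v → fullLeaves (G ∖ c) (graft t c r) v ≡ fullLeaves G t (punchIn c v)
  fullLeaves-∖ v = sym (trans
    (cong (ℕ._+ leaves (t (punchIn c v)))
      (trans (∑-remove {i = c} (λ u → ι (adj G (punchIn c v) u ∧ (fullDegree G t u ≡ᵇ 1))))
             (cong (ι (adj G (punchIn c v) c ∧ (fullDegree G t c ≡ᵇ 1)) ℕ.+_)
               (∑-cong λ u → cong (λ d → ι (adj G (punchIn c v) (punchIn c u) ∧ (d ≡ᵇ 1))) (sym (fullDegree-∖ u))))))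
    (rest v _))
    where
    ι-pendant : ∀ s → ι (children s ≡ᵇ 0) ≡ pendant s
    ι-pendant • = refl
    ι-pendant (_ ◁ _) = refl
    rest : ∀ v m → ι (adj G (punchIn c v) c ∧ (fullDegree G t c ≡ᵇ 1)) ℕ.+ m ℕ.+ leaves (t (punchIn c v))
                 ≡ m ℕ.+ leaves (graft t c r v)
    rest v m with v Fin.≟ r
    ... | yes refl rewrite Defs.sym G (punchIn c r) c | c~r | graft-at t c r | fullDegree-pendant | ι-pendant (t c) =
      trans (cong (ℕ._+ leaves (t (punchIn c r))) (ℕ.+-comm (pendant (t c)) m)) (ℕ.+-assoc m _ _)
    ... | no v≢r rewrite Defs.sym G (punchIn c v) c | c≁ v v≢r | graft-off t c v≢r = refl

  -- The condition at c moves into `Supported` of the grafted tree: c has degree one more than its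
  -- number of children, so it is a non-leaf exactly when it has children.
  fullySupported-∖ : fullDegree G t (punchIn c r) ≢ 1 →
    FullySupported G t ⇔ FullySupported (G ∖ c) (graft t c r)
  fullySupported-∖ r≢1 = mk⇔ to from
    where
    to : FullySupported G t → FullySupported (G ∖ c) (graft t c r)
    to h v = (λ d≢1 → subst OneOrTwo (sym (fullLeaves-∖ v))
               (proj₁ (h (punchIn c v)) (d≢1 ∘ trans (fullDegree-∖ v))))
           , supported
      where
      supported : Supported (graft t c r v)
      supported with v Fin.≟ r
      ... | yes refl = subst Supported (sym (graft-at t c r))
        ( proj₂ (h (punchIn c r)) , proj₂ (h c)
        , λ k≢0 → subst OneOrTwo (fullLeaves-pendant r≢1)
            (proj₁ (h c) λ d≡1 → k≢0 (ℕ.suc-injective (trans (sym fullDegree-pendant) d≡1))))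
      ... | no v≢r = subst Supported (sym (graft-off t c v≢r)) (proj₂ (h (punchIn c v)))
    from : FullySupported (G ∖ c) (graft t c r) → FullySupported G t
    from h v with c Fin.≟ v
    ... | yes refl = let _ , sup , good = subst Supported (graft-at t c r) (proj₂ (h r)) in
      (λ d≢1 → subst OneOrTwo (sym (fullLeaves-pendant r≢1))
        (good λ k≡0 → d≢1 (trans fullDegree-pendant (cong suc k≡0)))) , sup
    ... | no c≢v = subst (λ v → (fullDegree G t v ≢ 1 → OneOrTwo (fullLeaves G t v)) × Supported (t v))
                     (punchIn-punchOut c≢v) (kept (punchOut c≢v))
      where
      kept : ∀ v → (fullDegree G t (punchIn c v) ≢ 1 → OneOrTwo (fullLeaves G t (punchIn c v)))
                   × Supported (t (punchIn c v))
      kept v = (λ d≢1 → subst OneOrTwo (fullLeaves-∖ v) (proj₁ (h v) (d≢1 ∘ trans (sym (fullDegree-∖ v)))))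
             , supported
        where
        supported : Supported (t (punchIn c v))
        supported with v Fin.≟ r
        ... | yes refl = proj₁ (subst Supported (graft-at t c r) (proj₂ (h r)))
        ... | no v≢r = subst Supported (graft-off t c v≢r) (proj₂ (h v))

module Φ = DominationWeights dualSemiring chosen skipped

open CommutativeSemiring dualSemiring using ()
  renaming ( _+_ to _⊕_; _*_ to _⊗_; 0# to 0ᵈ; +-assoc to ⊕-assoc; zeroˡ to ⊗-zeroˡ
           ; *-commutativeMonoid to ⊗-commutativeMonoid )
open CommutativeMonoidSum ⊗-commutativeMonoid using () renaming (sum to ∏; sum-remove to ∏-remove)

pendantEdge⇒Pendant : ∀ {n} {G : Graph (suc n)} {ρ c r} → PendantEdge G ρ c (punchIn c r) → Pendant G c r
pendantEdge⇒Pendant {G = G} {c = c} {r} edge = T⇒≡true c~r , ≁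
  where
  open PendantEdge edge
  ≁ : ∀ v → v ≢ r → adj G c (punchIn c v) ≡ false
  ≁ v v≢r with adj G c (punchIn c v) in eq
  ... | false = refl
  ... | true  = ⊥-elim (v≢r (punchIn-injective c v r (only (subst T (sym eq) tt))))

punchIn-view : ∀ {n} {c v : Fin (suc n)} → c ≢ v → ∃ λ v′ → v ≡ punchIn c v′
punchIn-view c≢v = punchOut c≢v , sym (punchIn-punchOut c≢v)

record Collapse {n} (G : Graph n) (t : Fin n → Rooted) (ρ : Fin n) : Set where
  field
    tree      : Rooted
    weight≡   : Φ.totalWeight G t ≡ Dual.X tree ⊕ Dual.Y tree
    children≡ : children tree ≡ fullDegree G t ρ
    leaves⇔   : fullDegree G t ρ ≢ 1 → FullySupported G t ⇔ (OneOrTwo (leaves tree) × Supported tree)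

collapse : ∀ {n} (G : Graph (suc n)) t ρ → Acyclic G → ConnectedTo G ρ → Collapse G t ρ
collapse {zero} G t zero _ _ = record
  { tree = t zero
  ; weight≡ = Φ.totalWeight-single G t
  ; children≡ = sym d≡
  ; leaves⇔ = λ d≢1 → mk⇔
      (λ h → subst OneOrTwo l≡ (proj₁ (h zero) d≢1) , proj₂ (h zero))
      (λ { (l , sup) zero → (λ _ → subst OneOrTwo (sym l≡) l) , sup })
  }
  where
  d≡ : fullDegree G t zero ≡ children (t zero)
  d≡ rewrite irref G zero = refl
  l≡ : fullLeaves G t zero ≡ leaves (t zero)
  l≡ rewrite irref G zero = refl
collapse {suc n} G t ρ acyclic conn with pendantEdge G ρ acyclic conn
... | c , r , edge with punchIn-view (PendantEdge.c≢ρ edge) | punchIn-view (Adj⇒≢ G (PendantEdge.c~r edge))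
... | ρ′ , refl | r′ , refl = record
  { tree = tree
  ; weight≡ = trans (Φ.totalWeight-∖ G t c r′ pend) weight≡
  ; children≡ = trans children≡ ρ≡
  ; leaves⇔ = λ ρ≢1 →
      let module E₁ = Equivalence (fullySupported-∖ G t c r′ pend (r≢1 ρ≢1 (PendantEdge.anchored edge)))
          module E₂ = Equivalence (leaves⇔ (ρ≢1 ∘ trans (sym ρ≡)))
      in mk⇔ (E₂.to ∘ E₁.to) (E₁.from ∘ E₂.from)
  }
  where
  pend : Pendant G c r′
  pend = pendantEdge⇒Pendant edge
  ρ≡ : fullDegree (G ∖ c) (graft t c r′) ρ′ ≡ fullDegree G t (punchIn c ρ′)
  ρ≡ = fullDegree-∖ G t c r′ pend ρ′
  open Collapse (collapse (G ∖ c) (graft t c r′) ρ′ (acyclic-∖ G c acyclic) (connectedTo-∖ edge conn))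
  -- Either r is the root, a non-leaf by assumption, or `anchored` supplies a second neighbour
  -- besides c.
  r≢1 : fullDegree G t (punchIn c ρ′) ≢ 1 →
    punchIn c r′ ≡ punchIn c ρ′ ⊎ (∃ λ w → w ≢ c × Adj G (punchIn c r′) w) →
    fullDegree G t (punchIn c r′) ≢ 1
  r≢1 ρ≢1 (inj₁ eq) = ρ≢1 ∘ trans (cong (fullDegree G t) (sym eq))
  r≢1 _ (inj₂ (w , w≢c , r~w)) d≡1 = ℕ.<⇒≱
    (ℕ.≤-trans (2≤deg G w≢c (Adj-sym G (PendantEdge.c~r edge)) r~w) (ℕ.m≤m+n _ _)) (ℕ.≤-reflexive d≡1)

-- Dominating sets of the graph itself

trivial : ∀ {n} → Fin n → Rooted
trivial _ = •

⋁⁺ : ∀ {n} (f : Fin n → Bool) i → f i ≡ true → ⋁ f ≡ true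
⋁⁺ f zero    eq = cong (_∨ ⋁ (f ∘ suc)) eq
⋁⁺ f (suc i) eq = trans (cong (f zero ∨_) (⋁⁺ (f ∘ suc) i eq)) (Bool.∨-zeroʳ (f zero))

⋁⁻ : ∀ {n} (f : Fin n → Bool) → ⋁ f ≡ true → ∃ λ i → f i ≡ true
⋁⁻ {suc n} f eq with f zero in eq₀
... | true  = zero , eq₀
... | false = let i , eqᵢ = ⋁⁻ (f ∘ suc) eq in suc i , eqᵢ

dominating⇒ : ∀ {n} (G : Graph n) S → IsDominating G S → ∀ v → lookup S v ∨ dominated G S v ≡ true
dominating⇒ G S dom v with dom v
... | inj₁ v∈S = cong (_∨ dominated G S v) ([]=⇒lookup v∈S)
... | inj₂ (u , u∈S , u~v) = trans
  (cong (lookup S v ∨_) (⋁⁺ (λ u → lookup S u ∧ adj G u v) u (cong₂ _∧_ ([]=⇒lookup u∈S) (T⇒≡true u~v))))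
  (Bool.∨-zeroʳ _)

dominating⇐ : ∀ {n} (G : Graph n) S → (∀ v → lookup S v ∨ dominated G S v ≡ true) → IsDominating G S
dominating⇐ G S h v with lookup S v in v∈S | h v
... | true  | _ = inj₁ (lookup⇒[]= v S v∈S)
... | false | d with ⋁⁻ (λ u → lookup S u ∧ adj G u v) d
...   | u , eq = inj₂
  (u , lookup⇒[]= u S (Bool.∧-conicalˡ _ _ eq) , subst T (sym (Bool.∧-conicalʳ (lookup S u) _ eq)) tt)

excessOf : ℕ → ℕ → ℕ → ℤ
excessOf n num total = + 3 * + total - + 2 * + n * + num

excessOf-chosen : ∀ n s → chosen ⊗ (1ℤ , excessOf n 1 s) ≡ (1ℤ , excessOf (suc n) 1 (suc s))
excessOf-chosen n s = cong (1ℤ ,_) (eq (+ n) (+ s))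
  where
  eq : ∀ n s → 1ℤ * 1ℤ + 1ℤ * (+ 3 * s - + 2 * n * 1ℤ) ≡ + 3 * (1ℤ + s) - + 2 * (1ℤ + n) * 1ℤ
  eq = solve-∀

excessOf-skipped : ∀ n s → skipped ⊗ (1ℤ , excessOf n 1 s) ≡ (1ℤ , excessOf (suc n) 1 s)
excessOf-skipped n s = cong (1ℤ ,_) (eq (+ n) (+ s))
  where
  eq : ∀ n s → (- + 2) * 1ℤ + 1ℤ * (+ 3 * s - + 2 * n * 1ℤ) ≡ + 3 * s - + 2 * (1ℤ + n) * 1ℤ
  eq = solve-∀

-- With s chosen vertices the product is (1 + ε)^s (1 - 2ε)^(n - s) = 1 + (3s - 2n)ε.
∏-dominating : ∀ {n} (S : Subset n) (d : Fin n → Bool) → (∀ v → lookup S v ∨ d v ≡ true) →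
  ∏ (λ v → Φ.local • (lookup S v) (d v)) ≡ (1ℤ , excessOf n 1 ∣ S ∣)
∏-dominating [] d h = refl
∏-dominating {suc n} (true ∷ S) d h =
  trans (cong (chosen ⊗_) (∏-dominating S (d ∘ suc) (h ∘ suc))) (excessOf-chosen n ∣ S ∣)
∏-dominating {suc n} (false ∷ S) d h =
  trans (cong₂ (λ β w → Φ.local • false β ⊗ w) (h zero) (∏-dominating S (d ∘ suc) (h ∘ suc)))
        (excessOf-skipped n ∣ S ∣)

-- The vertex v contributes the factor Y of the trivial tree, which is 0.
∏-undominated : ∀ {n} (S : Subset n) (d : Fin n → Bool) v → lookup S v ∨ d v ≢ true →
  ∏ (λ v → Φ.local • (lookup S v) (d v)) ≡ 0ᵈ
∏-undominated {suc n} S d v h = trans (∏-remove {i = v} w)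
  (trans (cong (_⊗ ∏ (w ∘ punchIn v)) (local≡0 (lookup S v) (d v) h)) (⊗-zeroˡ (∏ (w ∘ punchIn v))))
  where
  w : Fin (suc n) → ℤ × ℤ
  w v = Φ.local • (lookup S v) (d v)
  local≡0 : ∀ s d → s ∨ d ≢ true → Φ.local • s d ≡ 0ᵈ
  local≡0 true d h = ⊥-elim (h refl)
  local≡0 false true h = ⊥-elim (h refl)
  local≡0 false false h = refl

weight-dominating : ∀ {n} (G : Graph n) S → IsDominating G S →
  Φ.weight G trivial S ≡ (1ℤ , excessOf n 1 ∣ S ∣)
weight-dominating G S dom = ∏-dominating S (dominated G S) (dominating⇒ G S dom)

weight-nondominating : ∀ {n} (G : Graph n) S → ¬ IsDominating G S →
  Φ.weight G trivial S ≡ 0ᵈ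
weight-nondominating G S ¬dom =
  let v , h = Fin.¬∀⟶∃¬ _ _ (λ v → (lookup S v ∨ dominated G S v) Bool.≟ true) (¬dom ∘ dominating⇐ G S)
  in ∏-undominated S (dominated G S) v h

∑ₗ : ∀ {A : Set} → (A → ℤ × ℤ) → List A → ℤ × ℤ
∑ₗ f = List.foldr (λ x → f x ⊕_) 0ᵈ

∑ₗ-allSubsets : ∀ n (f : Subset n → ℤ × ℤ) → ∑ₗ f (allSubsets n) ≡ Φ.∑ₛ f
∑ₗ-allSubsets zero f = cong₂ _,_ (ℤ.+-identityʳ _) (ℤ.+-identityʳ _)
∑ₗ-allSubsets (suc n) f = trans (pairs (allSubsets n)) (∑ₗ-allSubsets n _)
  where
  pairs : ∀ xs → ∑ₗ f (concatMap (λ s → (false ∷ s) ∷ (true ∷ s) ∷ []) xs)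
                 ≡ ∑ₗ (λ s → f (false ∷ s) ⊕ f (true ∷ s)) xs
  pairs [] = refl
  pairs (s ∷ xs) = trans (cong (λ z → f (false ∷ s) ⊕ (f (true ∷ s) ⊕ z)) (pairs xs))
                         (sym (⊕-assoc (f (false ∷ s)) (f (true ∷ s)) _))

∑ₗ-filter : ∀ {n} {P : Subset n → Set} (P? : Decidable P) (f : Subset n → ℤ × ℤ) →
  (∀ {S} → P S → f S ≡ (1ℤ , excessOf n 1 ∣ S ∣)) → (∀ {S} → ¬ P S → f S ≡ 0ᵈ) →
  ∀ xs → ∑ₗ f xs ≡ (+ length (filter P? xs) , excessOf n (length (filter P? xs)) (sum (map ∣_∣ (filter P? xs))))
∑ₗ-filter {n} P? f f-yes f-no [] = cong (0ℤ ,_) (eq (+ n))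
  where
  eq : ∀ n → 0ℤ ≡ + 3 * 0ℤ - + 2 * n * 0ℤ
  eq = solve-∀
∑ₗ-filter {n} P? f f-yes f-no (S ∷ xs) with P? S | ∑ₗ-filter P? f f-yes f-no xs
... | yes p | ih = trans (cong₂ _⊕_ (f-yes p) ih)
  (cong (+ suc (length (filter P? xs)) ,_)
    (eq (+ n) (+ ∣ S ∣) (+ length (filter P? xs)) (+ sum (map ∣_∣ (filter P? xs)))))
  where
  eq : ∀ n s ℓ σ → (+ 3 * s - + 2 * n * 1ℤ) + (+ 3 * σ - + 2 * n * ℓ) ≡ + 3 * (s + σ) - + 2 * n * (1ℤ + ℓ)
  eq = solve-∀
... | no ¬p | ih = trans (cong₂ _⊕_ (f-no ¬p) ih) (cong₂ _,_ (ℤ.+-identityˡ _) (ℤ.+-identityˡ _))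

totalWeight-trivial : ∀ {n} (G : Graph n) →
  Φ.totalWeight G trivial ≡ (+ numDom G , excessOf n (numDom G) (sumDom G))
totalWeight-trivial {n} G = trans (sym (∑ₗ-allSubsets n (Φ.weight G trivial)))
  (∑ₗ-filter (IsDominating? G) (Φ.weight G trivial) (weight-dominating G _) (weight-nondominating G _)
    (allSubsets n))

-- Degrees, leaf neighbours and the cross-multiplied average

length-filter-tabulate : ∀ {A : Set} {P : A → Set} (P? : Decidable P) {n} (f : Fin n → A) →
  length (filter P? (List.tabulate f)) ≡ ∑ (λ i → ι (does (P? (f i))))
length-filter-tabulate P? {zero} f = refl
length-filter-tabulate P? {suc n} f with does (P? (f zero))
... | true  = cong suc (length-filter-tabulate P? (f ∘ suc))
... | false = length-filter-tabulate P? (f ∘ suc)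

module _ {n} (G : Graph n) where

  degree≡deg : ∀ v → degree G v ≡ deg G v
  degree≡deg v = length-filter-tabulate (λ u → T? (adj G v u)) id

  degree≡ : ∀ v → degree G v ≡ fullDegree G trivial v
  degree≡ v = trans (degree≡deg v) (sym (ℕ.+-identityʳ _))

  leafNeighbors≡∑ : ∀ v → leafNeighbors G v ≡ ∑ (λ u → ι (adj G v u ∧ (degree G u ≡ᵇ 1)))
  leafNeighbors≡∑ v = length-filter-tabulate (λ u → T? (adj G v u) ×-dec IsLeaf? G u) id

  leafNeighbors≡ : ∀ v → leafNeighbors G v ≡ fullLeaves G trivial v
  leafNeighbors≡ v = trans (leafNeighbors≡∑ v)
    (trans (∑-cong λ u → cong (λ d → ι (adj G v u ∧ (d ≡ᵇ 1))) (degree≡ u)) (sym (ℕ.+-identityʳ _)))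

  support : ∀ v → 1 ℕ.≤ leafNeighbors G v → IsSupport G v
  support v 1≤ =
    let u , eq = ∑ι⁻ (λ u → adj G v u ∧ (degree G u ≡ᵇ 1)) (subst (1 ℕ.≤_) (leafNeighbors≡∑ v) 1≤)
    in u , subst T (sym (Bool.∧-conicalˡ _ _ eq)) tt
         , ℕ.≡ᵇ⇒≡ (degree G u) 1 (subst T (sym (Bool.∧-conicalʳ (adj G v u) _ eq)) tt)
    where
    ∑ι⁻ : ∀ {m} (f : Fin m → Bool) → 1 ℕ.≤ ∑ (ι ∘ f) → ∃ λ i → f i ≡ true
    ∑ι⁻ {suc m} f h with f zero in eq
    ... | true  = zero , eq
    ... | false = let i , eqᵢ = ∑ι⁻ (f ∘ suc) h in suc i , eqᵢ

  SupportCondition : Set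
  SupportCondition = ∀ v → ¬ IsLeaf G v → IsSupport G v × 1 ℕ.≤ leafNeighbors G v × leafNeighbors G v ℕ.≤ 2

  fullySupported⇔ : FullySupported G trivial ⇔ SupportCondition
  fullySupported⇔ = mk⇔
    (λ h v ¬leaf → let oneOrTwo = subst OneOrTwo (sym (leafNeighbors≡ v))
                                    (proj₁ (h v) (¬leaf ∘ trans (degree≡ v)))
                   in support v (proj₁ oneOrTwo) , oneOrTwo)
    (λ h v → (λ d≢1 → subst OneOrTwo (leafNeighbors≡ v) (proj₂ (h v (d≢1 ∘ trans (sym (degree≡ v)))))) , tt)

  private
    3s≡ : + 3 * + sumDom G ≡ + (3 ℕ.* sumDom G)
    3s≡ = sym (ℤ.pos-* 3 (sumDom G))
    2nd≡ : + 2 * + n * + numDom G ≡ + (2 ℕ.* n ℕ.* numDom G)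
    2nd≡ = trans (cong (_* + numDom G) (sym (ℤ.pos-* 2 n))) (sym (ℤ.pos-* (2 ℕ.* n) (numDom G)))

  excess⇒≤ : excessOf n (numDom G) (sumDom G) ≤ 0ℤ → AvdLe2n/3 G
  excess⇒≤ h = ℤ.drop‿+≤+ (subst₂ _≤_ 3s≡ 2nd≡ (ℤ.i-j≤0⇒i≤j h))

  excess⇔≡ : excessOf n (numDom G) (sumDom G) ≡ 0ℤ ⇔ AvdEq2n/3 G
  excess⇔≡ = mk⇔
    (λ h → ℤ.+-injective (trans (sym 3s≡) (trans (ℤ.i-j≡0⇒i≡j _ _ h) 2nd≡)))
    (λ h → ℤ.i≡j⇒i-j≡0 (trans 3s≡ (trans (cong +_ h) (sym 2nd≡))))

-- The bound and its equality case

avd≤ : ∀ {n} (G : Graph (2 ℕ.+ n)) → IsTree G → AvdLe2n/3 G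
avd≤ {n} G (conn , acyclic) = excess⇒≤ G (subst (_≤ 0ℤ)
  (cong proj₂ (trans (sym weight≡) (totalWeight-trivial G)))
  (excess≤0 tree (subst (1 ℕ.≤_) (sym children≡) 1≤deg)))
  where
  open Collapse (collapse G trivial zero acyclic (connected⇒connectedTo G conn zero))
  1≤deg : 1 ℕ.≤ fullDegree G trivial zero
  1≤deg = let v , v~0 = hasNeighbour G {suc zero} (λ ()) (connected⇒connectedTo G conn zero (suc zero)) in
    ℕ.≤-trans (subst (λ β → 1 ℕ.≤ ι β) (sym (T⇒≡true (Adj-sym G v~0))) ℕ.≤-refl)
      (ℕ.≤-trans (term≤∑ (λ u → ι (adj G zero u)) v) (ℕ.m≤m+n _ 0))

avd≡⇔-rooted : ∀ {n} (G : Graph (suc n)) → IsTree G → ∀ ρ → 2 ℕ.≤ deg G ρ → AvdEq2n/3 G ⇔ SupportCondition G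
avd≡⇔-rooted {n} G (conn , acyclic) ρ 2≤d = mk⇔
  (E₁.to ∘ E₂.from ∘ E₃.to ∘ trans excess≡ ∘ E₄.from)
  (E₄.to ∘ trans (sym excess≡) ∘ E₃.from ∘ E₂.to ∘ E₁.from)
  where
  open Collapse (collapse G trivial ρ acyclic (connected⇒connectedTo G conn ρ))
  2≤full : 2 ℕ.≤ fullDegree G trivial ρ
  2≤full = ℕ.≤-trans 2≤d (ℕ.m≤m+n _ 0)
  excess≡ : excess tree ≡ excessOf (suc n) (numDom G) (sumDom G)
  excess≡ = cong proj₂ (trans (sym weight≡) (totalWeight-trivial G))
  module E₁ = Equivalence (fullySupported⇔ G)
  module E₂ = Equivalence (leaves⇔ λ d≡1 → ℕ.<⇒≱ 2≤full (ℕ.≤-reflexive d≡1))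
  module E₃ = Equivalence (excess≡0⇔ tree (subst (2 ℕ.≤_) (sym children≡) 2≤full))
  module E₄ = Equivalence (excess⇔≡ G)

-- A single edge offers no root of degree two. Both sides hold: both vertices are leaves, and the
-- weights of the four subsets have total ε-coefficient 0.
avd≡⇔-edge : (G : Graph 2) → Adj G zero (suc zero) → AvdEq2n/3 G ⇔ SupportCondition G
avd≡⇔-edge G 0~1 = mk⇔ (λ _ v ¬leaf → ⊥-elim (¬leaf (leaf v)))
  (λ _ → Equivalence.to (excess⇔≡ G) (trans (cong proj₂ (sym (totalWeight-trivial G))) weight≡0))
  where
  0≁0 : adj G zero zero ≡ false
  0≁0 = irref G zero
  1≁1 : adj G (suc zero) (suc zero) ≡ false
  1≁1 = irref G (suc zero)
  0~1′ : adj G zero (suc zero) ≡ true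
  0~1′ = T⇒≡true 0~1
  1~0′ : adj G (suc zero) zero ≡ true
  1~0′ = T⇒≡true (Adj-sym G 0~1)
  leaf : ∀ v → IsLeaf G v
  leaf v = trans (degree≡deg G v) (deg≡1 v)
    where
    deg≡1 : ∀ v → deg G v ≡ 1
    deg≡1 zero       rewrite 0≁0 | 0~1′ = refl
    deg≡1 (suc zero) rewrite 1≁1 | 1~0′ = refl
  weight≡0 : proj₂ (Φ.totalWeight G trivial) ≡ 0ℤ
  weight≡0 rewrite 0~1′ | 1~0′ = refl

-- The neighbour r of a pendant vertex c serves: without a further neighbour of r, the set of c and
-- r would be closed under adjacency and, by connectedness, contain all of the at least three
-- vertices.
nonLeaf : ∀ {n} (G : Graph (3 ℕ.+ n)) → IsTree G → ∃ λ ρ → 2 ℕ.≤ deg G ρ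
nonLeaf G (conn , acyclic) with pendantEdge G zero acyclic (connected⇒connectedTo G conn zero)
... | c , r , edge with any? (λ w → ¬? (w Fin.≟ c) ×-dec T? (adj G r w))
...   | yes (w , w≢c , r~w) = r , 2≤deg G w≢c (Adj-sym G c~r) r~w
  where open PendantEdge edge
...   | no  ∄w = ⊥-elim (clash (end zero) (end (suc zero)) (end (suc (suc zero))))
  where
  open PendantEdge edge
  closed : ∀ {u} → Star (Adj G) u r → u ≡ c ⊎ u ≡ r
  closed ε = inj₂ refl
  closed {u} (u~w ◅ walk) with closed walk
  ... | inj₁ refl = inj₂ (only (Adj-sym G u~w))
  ... | inj₂ refl = case u Fin.≟ c of λ
    { (yes u≡c) → inj₁ u≡c
    ; (no u≢c) → ⊥-elim (∄w (u , u≢c , Adj-sym G u~w)) }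
  end : ∀ u → u ≡ c ⊎ u ≡ r
  end u = closed (connected⇒connectedTo G conn r u)
  clash : zero ≡ c ⊎ zero ≡ r → suc zero ≡ c ⊎ suc zero ≡ r → suc (suc zero) ≡ c ⊎ suc (suc zero) ≡ r → ⊥
  clash (inj₁ p) (inj₁ q) _        = case trans p (sym q) of λ ()
  clash (inj₁ p) _        (inj₁ q) = case trans p (sym q) of λ ()
  clash (inj₂ p) (inj₂ q) _        = case trans p (sym q) of λ ()
  clash (inj₂ p) _        (inj₂ q) = case trans p (sym q) of λ ()
  clash _        (inj₁ p) (inj₁ q) = case trans p (sym q) of λ ()
  clash _        (inj₂ p) (inj₂ q) = case trans p (sym q) of λ ()

avd≡⇔ : ∀ {n} (G : Graph (2 ℕ.+ n)) → IsTree G → AvdEq2n/3 G ⇔ SupportCondition G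
avd≡⇔ {zero} G (conn , _)
  with hasNeighbour G {suc zero} {zero} (λ ()) (connected⇒connectedTo G conn zero (suc zero))
... | zero     , 0~0 = ⊥-elim (Adj⇒≢ G 0~0 refl)
... | suc zero , 1~0 = avd≡⇔-edge G (Adj-sym G 1~0)
avd≡⇔ {suc n} G tree = let ρ , 2≤d = nonLeaf G tree in avd≡⇔-rooted G tree ρ 2≤d

theorem1p2 : ∀ (n : ℕ) (G : Graph n) → n ℕ.≥ 2 → IsTree G →
    AvdLe2n/3 G ×
    (AvdEq2n/3 G ⇔ (∀ (v : Fin n) → ¬ IsLeaf G v →
    IsSupport G v × 1 ℕ.≤ leafNeighbors G v × leafNeighbors G v ℕ.≤ 2))
theorem1p2 (suc (suc n)) G (s≤s (s≤s _)) tree = avd≤ G tree , avd≡⇔ G tree
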